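{- Let $\Delta\ge 6$ and let $n=k\Delta+1+j$, where $k\geq\Delta-1$ and $2\leq j\leq\Delta-2$ are integers. Then the family $\mathcal{T}'''_{n,\Delta}$ is not empty and all trees in $\mathcal{T}'''_{n,\Delta}$ have the same value of $\sigma$-irregularity.
   Context: For a graph $G$, $\sigma(G)=\sum_{uv\in E(G)}(d(u)-d(v))^2$, where $d(u)$ is the degree of $u$. For a tree $T$, $m_{ij}=m_{ji}$ is the number of edges whose end-vertices have degrees $i$ and $j$. An internal leaf of a tree is a vertex of degree at least $2$ having precisely one neighbor of degree greater than $1$. A medium vertex is a vertex whose degree lies in $\{3,\ldots,\Delta-1\}$. The family $\mathcal{T}'''_{n,\Delta}$ consists of all trees $T$ on $n=k\Delta+1+j$ vertices with maximum degree $\Delta$ such that: (1) all internal leaves of $T$ have degree $\Delta$; (2) all vertices of $T$ have degree in $\{1,2,\Delta\}$, except precisely one medium vertex $w$, which has degree $j+1$; (3) $m_{22}=0$; (4) $w$ has precisely $j$ neighbors of degree $2$ and one neighbor of degree $\Delta$; (5) $m_{\Delta\Delta}=0$. -}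

module Defs where

open import Data.Fin.Base using (Fin; zero; suc; inject₁; fromℕ)
open import Data.Fin.Properties using (_<?_)
open import Data.List.Base using (List; allFin; cartesianProduct; filter; length; map)
open import Data.Nat.Base as ℕ using (ℕ; _+_; _^_; _≤_; ∣_-_∣)
open import Data.Nat.ListAction using (sum)
open import Data.Nat.Properties as ℕₚ using (_≟_)
open import Data.Product.Base using (_×_; _,_; ∃)
open import Data.Sum.Base using (_⊎_)
open import Function.Definitions using (Injective)
open import Level using (0ℓ)
open import Relation.Binary.Core using (Rel)
open import Relation.Binary.Construct.Closure.ReflexiveTransitive using (Star)
open import Relation.Binary.Definitions using (Decidable; Irreflexive; Symmetric)
open import Relation.Binary.PropositionalEquality using (_≡_; _≢_)
open import Relation.Nullary using (¬_; _×-dec_; _⊎-dec_)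

record Graph (n : ℕ) : Set₁ where
  infix 4 _~_ _~?_
  field
    _~_    : Rel (Fin n) 0ℓ
    _~?_   : Decidable _~_
    sym    : Symmetric _~_
    irrefl : Irreflexive _≡_ _~_

module _ {n : ℕ} (G : Graph n) where
  open Graph G using (_~_; _~?_)

  neighbours : Fin n → List (Fin n)
  neighbours v = filter (v ~?_) (allFin n)

  deg : Fin n → ℕ
  deg v = length (neighbours v)

  -- Each edge is listed once, as the pair (u , v) with u < v.
  edges : List (Fin n × Fin n)
  edges = filter (λ (u , v) → (u <? v) ×-dec (u ~? v))
                 (cartesianProduct (allFin n) (allFin n))

  σ : ℕ
  σ = sum (map (λ (u , v) → ∣ deg u - deg v ∣ ^ 2) edges)

  m : ℕ → ℕ → ℕ
  m i j = length (filter
    (λ (u , v) → ((deg u ≟ i) ×-dec (deg v ≟ j)) ⊎-dec ((deg u ≟ j) ×-dec (deg v ≟ i)))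
    edges)

  -- A cycle of length 3 + ℓ, given by its successive, pairwise distinct vertices.
  record Cycle (ℓ : ℕ) : Set where
    field
      vertex   : Fin (3 + ℓ) → Fin n
      distinct : Injective _≡_ _≡_ vertex
      step     : ∀ (i : Fin (2 + ℓ)) → vertex (inject₁ i) ~ vertex (suc i)
      close    : vertex (fromℕ (2 + ℓ)) ~ vertex zero

  record IsTree : Set where
    field
      nonempty  : 0 ℕ.< n
      connected : ∀ u v → Star _~_ u v
      acyclic   : ∀ ℓ → ¬ Cycle ℓ

  HasMaxDegree : ℕ → Set
  HasMaxDegree Δ = (∀ v → deg v ≤ Δ) × ∃ λ v → deg v ≡ Δ

  neighboursOfDegree : ℕ → Fin n → ℕ
  neighboursOfDegree d v = length (filter (λ u → deg u ≟ d) (neighbours v))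

  InternalLeaf : Fin n → Set
  InternalLeaf v =
    2 ≤ deg v × length (filter (λ u → 1 ℕₚ.<? deg u) (neighbours v)) ≡ 1

  Medium : ℕ → Fin n → Set
  Medium Δ v = 3 ≤ deg v × deg v ℕ.< Δ

-- Membership in the family 𝒯‴ of trees on n = k Δ + 1 + j vertices with maximum
-- degree Δ.  For 2 ≤ j ≤ Δ - 2 the number j is determined by n and Δ; it is kept
-- as a separate parameter, and the equation for n is left to the user.
record _∈𝒯‴[_,_] {n : ℕ} (T : Graph n) (Δ j : ℕ) : Set where
  field
    isTree         : IsTree T
    maxDegree      : HasMaxDegree T Δ
    internalLeaves : ∀ v → InternalLeaf T v → deg T v ≡ Δ
    w              : Fin n
    w-medium       : Medium T Δ w
    w-degree       : deg T w ≡ j + 1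
    other-degrees  : ∀ v → v ≢ w → deg T v ≡ 1 ⊎ deg T v ≡ 2 ⊎ deg T v ≡ Δ
    m₂₂≡0          : m T 2 2 ≡ 0
    w-neighbours-2 : neighboursOfDegree T 2 w ≡ j
    w-neighbours-Δ : neighboursOfDegree T Δ w ≡ 1
    mΔΔ≡0          : m T Δ Δ ≡ 0

{-# OPTIONS --safe #-}
-- Handshaking and |E| = n − 1 turn the conditions on a tree of the family into equations. With d = j + 1 the
-- degree of w, every edge joins degrees {1,Δ}, {2,Δ}, {d,Δ} or {d,2}, the last kind occurring j times. So every
-- other edge has exactly one end of degree Δ, which gives Δ N_Δ = |E| − j for the number N_Δ of vertices of
-- degree Δ; the vertex count and the degree sum then give N₁ and N₂. Moreover (d(u) − d(v))² = φ(d(u)) + φ(d(v))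
-- on these other edges, where φ(Δ) = 0 and φ(i) = (Δ − i)² for i = 1, 2, d, so that σ is, up to a constant, the
-- sum of d(u) φ(d(u)) over the vertices, which is determined by N₁ and N₂.
module Submission where

open import Data.Bool.Base using (true; false; if_then_else_)
open import Data.Fin.Base using (Fin; zero; suc; toℕ; inject₁; lower₁; fromℕ; fromℕ<)
import Data.Fin.Properties as Fin
open import Data.Fin.Properties using (toℕ<n; toℕ-fromℕ<; toℕ-injective)
open import Data.List.Base
  using (List; []; _∷_; _++_; [_]; allFin; cartesianProduct; filter; length; lookup; map; tabulate)
open import Data.List.Membership.Propositional using (_∈_; _∉_; lose)
open import Data.List.Membership.Propositional.Properties
  using (∈-allFin; ∈-filter⁺; ∈-filter⁻; ∈-cartesianProduct⁺; ∈-lookup; ∈-length)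
open import Data.List.Membership.Propositional.Properties.WithK using (unique∧set⇒bag)
open import Data.List.Properties
  using (map-cong; map-++; map-∘; map-tabulate; length-tabulate; filter-some; filter-notAll; filter-all; filter-none)
open import Data.List.Relation.Binary.BagAndSetEquality using (∼bag⇒↭)
open import Data.List.Relation.Binary.Permutation.Propositional using (_↭_)
import Data.List.Relation.Binary.Permutation.Propositional.Properties as Perm
open import Data.List.Relation.Unary.All as All using (All; []; _∷_)
import Data.List.Relation.Unary.All.Properties as All
open import Data.List.Relation.Unary.AllPairs using ([]; _∷_)
open import Data.List.Relation.Unary.Any using (here; there)
open import Data.List.Relation.Unary.Unique.Propositional using (Unique)
import Data.List.Relation.Unary.Unique.Propositional.Properties as Unique
open import Data.Nat.Base as ℕ using (ℕ; zero; suc; _+_; _*_; _∸_; _^_; _≤_; _<_; z≤n; s≤s; ∣_-_∣)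
open import Data.Nat.DivMod using (_/_; _%_; m≡m%n+[m/n]*n; m%n<n; [m+kn]%n≡m%n; m<n⇒m%n≡m)
open import Data.Nat.Induction using (<-wellFounded)
open import Data.Nat.ListAction using (sum)
open import Data.Nat.ListAction.Properties using (sum-++; sum-↭)
open import Data.Nat.Properties as ℕ hiding (_≟_)
open import Data.Nat.Tactic.RingSolver using (solve-∀)
open import Data.Product.Base using (_×_; _,_; ∃; ∃₂; proj₁; proj₂; uncurry)
open import Data.Sum.Base using (_⊎_; inj₁; inj₂; [_,_]′)
open import Function.Base using (_∘_; case_of_)
open import Function.Bundles using (mk⇔)
open import Function.Definitions using (Injective)
open import Induction.WellFounded using (Acc; acc)
open import Level using (Level; 0ℓ)
open import Relation.Binary.Construct.Closure.ReflexiveTransitive using (Star; ε; _◅_; _◅◅_; reverse)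
open import Relation.Binary.Definitions using (tri<; tri≈; tri>)
open import Relation.Binary.PropositionalEquality hiding ([_])
open import Relation.Nullary using (¬_; Dec; yes; no; does; contradiction; _×-dec_; _⊎-dec_)
open import Relation.Nullary.Decidable using (dec-true; dec-false)
open import Relation.Unary using (Pred) renaming (Decidable to Decidable₁)
open import Defs

-- The equation |E| = n - 1 has to be extracted from connectedness and the absence of explicit
-- cycles; for this a duplicate-free list of vertices is grown until it contains all of them. The
-- list of edge types rests on condition (1): a neighbour of degree 2 of a leaf would be an internal
-- leaf of degree other than Δ. All identities are in natural numbers without subtraction, so
-- corrections stand on the opposite side. For non-emptiness, a tree is given by a parent function
-- that sends each positive number to a smaller one: connectedness and acyclicity then follow from
-- the order. The numbering makes the children of each vertex an interval, which turns every degree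
-- into arithmetic. The vertex w starts j + 1 branches, each of which needs a centre of degree Δ;
-- the surplus blocks form a chain in which a former leaf becomes the link of degree 2 to the next
-- centre.

private variable
  a : Level
  A B : Set a
  P Q : Set a

-- Indicators of decidable propositions

𝟙 : Dec P → ℕ
𝟙 d = if does d then 1 else 0

𝟙-yes : (d : Dec P) → P → 𝟙 d ≡ 1
𝟙-yes d p = cong (if_then 1 else 0) (dec-true d p)

𝟙-no : (d : Dec P) → ¬ P → 𝟙 d ≡ 0
𝟙-no d ¬p = cong (if_then 1 else 0) (dec-false d ¬p)

𝟙-⇔ : (p? : Dec P) (q? : Dec Q) → (P → Q) → (Q → P) → 𝟙 p? ≡ 𝟙 q?
𝟙-⇔ (yes p) q? f g = sym (𝟙-yes q? (f p))
𝟙-⇔ (no ¬p) q? f g = sym (𝟙-no q? (¬p ∘ g))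

𝟙≤1 : (p? : Dec P) → 𝟙 p? ≤ 1
𝟙≤1 (yes _) = ≤-refl
𝟙≤1 (no _)  = z≤n

𝟙-× : (p? : Dec P) (q? : Dec Q) → 𝟙 (p? ×-dec q?) ≡ 𝟙 p? * 𝟙 q?
𝟙-× (yes _) (yes _) = refl
𝟙-× (yes _) (no _)  = refl
𝟙-× (no _)  _       = refl

𝟙-⊎ : (p? : Dec P) (q? : Dec Q) → (P → ¬ Q) → 𝟙 (p? ⊎-dec q?) ≡ 𝟙 p? + 𝟙 q?
𝟙-⊎ (yes p) (yes q) p⇒¬q = contradiction q (p⇒¬q p)
𝟙-⊎ (yes _) (no _)  _    = refl
𝟙-⊎ (no _)  (yes _) _    = refl
𝟙-⊎ (no _)  (no _)  _    = refl

-- Sums over lists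

∑ : (A → ℕ) → List A → ℕ
∑ f xs = sum (map f xs)

∑-cong : {f g : A → ℕ} → f ≗ g → ∀ xs → ∑ f xs ≡ ∑ g xs
∑-cong f≗g xs = cong sum (map-cong f≗g xs)

∑-cong-∈ : {f g : A → ℕ} (xs : List A) → (∀ {x} → x ∈ xs → f x ≡ g x) → ∑ f xs ≡ ∑ g xs
∑-cong-∈ []       eq = refl
∑-cong-∈ (x ∷ xs) eq = cong₂ _+_ (eq (here refl)) (∑-cong-∈ xs (eq ∘ there))

∑-↭ : (f : A → ℕ) {xs ys : List A} → xs ↭ ys → ∑ f xs ≡ ∑ f ys
∑-↭ f p = sum-↭ (Perm.map⁺ f p)

∑-0 : (xs : List A) → ∑ (λ _ → 0) xs ≡ 0
∑-0 []       = refl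
∑-0 (x ∷ xs) = ∑-0 xs

∑-const : ∀ c (xs : List A) → ∑ (λ _ → c) xs ≡ length xs * c
∑-const c []       = refl
∑-const c (x ∷ xs) = cong (c +_) (∑-const c xs)

∑-+ : ∀ (f g : A → ℕ) xs → ∑ (λ x → f x + g x) xs ≡ ∑ f xs + ∑ g xs
∑-+ f g []       = refl
∑-+ f g (x ∷ xs) = trans (cong (f x + g x +_) (∑-+ f g xs)) (lemma (f x) (g x) (∑ f xs) (∑ g xs))
  where
  lemma : ∀ a b c d → a + b + (c + d) ≡ a + c + (b + d)
  lemma = solve-∀

∑-* : ∀ c (f : A → ℕ) xs → ∑ (λ x → c * f x) xs ≡ c * ∑ f xs
∑-* c f []       = sym (*-zeroʳ c)
∑-* c f (x ∷ xs) = trans (cong (c * f x +_) (∑-* c f xs)) (sym (*-distribˡ-+ c (f x) (∑ f xs)))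

∑-comm : ∀ (f : A → B → ℕ) xs ys → ∑ (λ x → ∑ (f x) ys) xs ≡ ∑ (λ y → ∑ (λ x → f x y) xs) ys
∑-comm f []       ys = sym (∑-0 ys)
∑-comm f (x ∷ xs) ys = trans (cong (∑ (f x) ys +_) (∑-comm f xs ys))
                             (sym (∑-+ (f x) (λ y → ∑ (λ z → f z y) xs) ys))

∑-map : ∀ (f : B → ℕ) (g : A → B) xs → ∑ f (map g xs) ≡ ∑ (f ∘ g) xs
∑-map f g xs = cong sum (sym (map-∘ xs))

∑-++ : ∀ (f : A → ℕ) xs ys → ∑ f (xs ++ ys) ≡ ∑ f xs + ∑ f ys
∑-++ f xs ys = trans (cong sum (map-++ f xs ys)) (sum-++ (map f xs) (map f ys))

∑-cartesianProduct : ∀ (f : A × B → ℕ) xs ys →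
  ∑ f (cartesianProduct xs ys) ≡ ∑ (λ x → ∑ (λ y → f (x , y)) ys) xs
∑-cartesianProduct f []       ys = refl
∑-cartesianProduct f (x ∷ xs) ys =
  trans (∑-++ f (map (x ,_) ys) (cartesianProduct xs ys))
        (cong₂ _+_ (∑-map f (x ,_) ys) (∑-cartesianProduct f xs ys))

module _ {P : Pred A 0ℓ} (P? : Decidable₁ P) where

  ∑-filter : ∀ f xs → ∑ f (filter P? xs) ≡ ∑ (λ x → 𝟙 (P? x) * f x) xs
  ∑-filter f [] = refl
  ∑-filter f (x ∷ xs) with does (P? x)
  ... | true  = cong₂ _+_ (sym (+-identityʳ (f x))) (∑-filter f xs)
  ... | false = ∑-filter f xs

  length-filter≡∑ : ∀ xs → length (filter P? xs) ≡ ∑ (𝟙 ∘ P?) xs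
  length-filter≡∑ [] = refl
  length-filter≡∑ (x ∷ xs) with does (P? x)
  ... | true  = cong suc (length-filter≡∑ xs)
  ... | false = length-filter≡∑ xs

length≡∑ : (xs : List A) → length xs ≡ ∑ (λ _ → 1) xs
length≡∑ xs = sym (trans (∑-const 1 xs) (*-identityʳ (length xs)))

∈⇒≤∑ : ∀ (f : A → ℕ) {x xs} → x ∈ xs → f x ≤ ∑ f xs
∈⇒≤∑ f (here refl) = m≤m+n _ _
∈⇒≤∑ f (there x∈)  = ≤-trans (∈⇒≤∑ f x∈) (m≤n+m _ _)

∑-single : ∀ (f : A → ℕ) {x xs} → Unique xs → x ∈ xs →
  (∀ {y} → y ∈ xs → y ≢ x → f y ≡ 0) → ∑ f xs ≡ f x
∑-single f {x} {.x ∷ xs} (x≢ ∷ _) (here refl) f≡0 =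
  trans (cong (f x +_) (trans (∑-cong-∈ xs λ y∈ → f≡0 (there y∈) (≢-sym (All.lookup x≢ y∈))) (∑-0 xs)))
        (+-identityʳ (f x))
∑-single f (y≢ ∷ u) (there x∈) f≡0 =
  cong₂ _+_ (f≡0 (here refl) (All.lookup y≢ x∈)) (∑-single f u x∈ (f≡0 ∘ there))

lookup-injective : {xs : List A} → Unique xs → Injective _≡_ _≡_ (lookup xs)
lookup-injective (x≢ ∷ u) {zero}  {zero}  _  = refl
lookup-injective (x≢ ∷ u) {zero}  {suc j} eq = contradiction eq (All.lookup x≢ (∈-lookup j))
lookup-injective (x≢ ∷ u) {suc i} {zero}  eq = contradiction (sym eq) (All.lookup x≢ (∈-lookup i))
lookup-injective (x≢ ∷ u) {suc i} {suc j} eq = cong suc (lookup-injective u eq)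

complete⇒↭allFin : ∀ {n} {xs : List (Fin n)} → Unique xs → (∀ x → x ∈ xs) → xs ↭ allFin n
complete⇒↭allFin {n} u all = ∼bag⇒↭ (unique∧set⇒bag u (Unique.allFin⁺ n) (mk⇔ (λ _ → ∈-allFin _) (λ _ → all _)))

-- Degree sums in trees

module _ {n : ℕ} (G : Graph n) where
  open Graph G using (_~_; _~?_; irrefl) renaming (sym to ~-sym)

  𝔸 : Fin n → Fin n → ℕ
  𝔸 u v = 𝟙 (u ~? v)

  𝔸-sym : ∀ u v → 𝔸 u v ≡ 𝔸 v u
  𝔸-sym u v = 𝟙-⇔ (u ~? v) (v ~? u) ~-sym ~-sym

  ∑-neighbours : ∀ u f → ∑ f (neighbours G u) ≡ ∑ (λ v → 𝔸 u v * f v) (allFin n)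
  ∑-neighbours u f = ∑-filter (u ~?_) f (allFin n)

  deg≡∑ : ∀ u → deg G u ≡ ∑ (𝔸 u) (allFin n)
  deg≡∑ u = length-filter≡∑ (u ~?_) (allFin n)

  ∈-neighbours⁺ : ∀ {u v} → u ~ v → v ∈ neighbours G u
  ∈-neighbours⁺ u~v = ∈-filter⁺ (_ ~?_) (∈-allFin _) u~v

  ∈-neighbours⁻ : ∀ {u v} → v ∈ neighbours G u → u ~ v
  ∈-neighbours⁻ v∈ = proj₂ (∈-filter⁻ (_ ~?_) {xs = allFin n} v∈)

  ∈-edges⁻ : ∀ {u v} → (u , v) ∈ edges G → u ~ v
  ∈-edges⁻ e∈ = proj₂ (proj₂ (∈-filter⁻ _ {xs = cartesianProduct (allFin n) (allFin n)} e∈))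

  ~⇒∈-edges : ∀ {u v} → u ~ v → (u , v) ∈ edges G ⊎ (v , u) ∈ edges G
  ~⇒∈-edges {u} {v} u~v with Fin.<-cmp u v
  ... | tri< u<v _ _ = inj₁ (∈-filter⁺ _ (∈-cartesianProduct⁺ (∈-allFin u) (∈-allFin v)) (u<v , u~v))
  ... | tri≈ _ u≡v _ = contradiction u~v (irrefl u≡v)
  ... | tri> _ _ v<u = inj₂ (∈-filter⁺ _ (∈-cartesianProduct⁺ (∈-allFin v) (∈-allFin u)) (v<u , ~-sym u~v))

  -- Both sums run over ordered pairs of adjacent vertices. `L` picks the pairs with u < v,
  -- exchanging the order of summation turns the second term into one with `L v u`, and exactly one
  -- of u < v and v < u holds for adjacent u and v.
  ∑-edges : ∀ (F : Fin n → Fin n → ℕ) →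
    ∑ (λ (u , v) → F u v + F v u) (edges G) ≡ ∑ (λ u → ∑ (F u) (neighbours G u)) (allFin n)
  ∑-edges F = begin
    ∑ (λ (u , v) → F u v + F v u) (edges G)
      ≡⟨ ∑-filter _ _ (cartesianProduct V V) ⟩
    ∑ (λ (u , v) → L u v * (F u v + F v u)) (cartesianProduct V V)
      ≡⟨ ∑-cartesianProduct _ V V ⟩
    ∑∑ (λ u v → L u v * (F u v + F v u))
      ≡⟨ ∑∑-cong (λ u v → *-distribˡ-+ (L u v) (F u v) (F v u)) ⟩
    ∑∑ (λ u v → L u v * F u v + L u v * F v u)
      ≡⟨ ∑∑-+ _ _ ⟩
    ∑∑ (λ u v → L u v * F u v) + ∑∑ (λ u v → L u v * F v u)
      ≡⟨ cong (∑∑ (λ u v → L u v * F u v) +_) (∑-comm _ V V) ⟩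
    ∑∑ (λ u v → L u v * F u v) + ∑∑ (λ u v → L v u * F u v)
      ≡⟨ ∑∑-+ _ _ ⟨
    ∑∑ (λ u v → L u v * F u v + L v u * F u v)
      ≡⟨ ∑∑-cong (λ u v → trans (sym (*-distribʳ-+ (F u v) (L u v) (L v u))) (cong (_* F u v) (L-L u v))) ⟩
    ∑∑ (λ u v → 𝔸 u v * F u v)
      ≡⟨ ∑-cong (λ u → sym (∑-neighbours u (F u))) V ⟩
    ∑ (λ u → ∑ (F u) (neighbours G u)) V ∎
    where
    open ≡-Reasoning
    V = allFin n
    ∑∑ : (Fin n → Fin n → ℕ) → ℕ
    ∑∑ f = ∑ (λ u → ∑ (f u) V) V
    ∑∑-cong : ∀ {f g} → (∀ u v → f u v ≡ g u v) → ∑∑ f ≡ ∑∑ g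
    ∑∑-cong eq = ∑-cong (λ u → ∑-cong (eq u) V) V
    ∑∑-+ : ∀ f g → ∑∑ (λ u v → f u v + g u v) ≡ ∑∑ f + ∑∑ g
    ∑∑-+ f g = trans (∑-cong (λ u → ∑-+ (f u) (g u) V) V) (∑-+ _ _ V)
    L : Fin n → Fin n → ℕ
    L u v = 𝟙 ((u Fin.<? v) ×-dec (u ~? v))
    L-L : ∀ u v → L u v + L v u ≡ 𝔸 u v
    L-L u v with u ~? v
    ... | no u≁v = cong₂ _+_ (𝟙-no ((u Fin.<? v) ×-dec no u≁v) (u≁v ∘ proj₂))
                              (𝟙-no ((v Fin.<? u) ×-dec (v ~? u)) (u≁v ∘ ~-sym ∘ proj₂))
    ... | yes u~v with Fin.<-cmp u v
    ...   | tri< u<v _ v≮u = cong₂ _+_ (𝟙-yes ((u Fin.<? v) ×-dec yes u~v) (u<v , u~v))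
                                       (𝟙-no ((v Fin.<? u) ×-dec (v ~? u)) (v≮u ∘ proj₁))
    ...   | tri≈ _ u≡v _ = contradiction u~v (irrefl u≡v)
    ...   | tri> u≮v _ v<u = cong₂ _+_ (𝟙-no ((u Fin.<? v) ×-dec yes u~v) (u≮v ∘ proj₁))
                                       (𝟙-yes ((v Fin.<? u) ×-dec (v ~? u)) (v<u , ~-sym u~v))

  -- Handshaking with weights. The weight 1, the indicator of degree Δ and φ of the degree yield the
  -- edge sums needed for |E|, for the vertices of degree Δ and for σ.
  ∑-edges-endpoints : ∀ (f : Fin n → ℕ) →
    ∑ (λ (u , v) → f u + f v) (edges G) ≡ ∑ (λ u → deg G u * f u) (allFin n)
  ∑-edges-endpoints f = trans (∑-edges (λ u _ → f u)) (∑-cong (λ u → ∑-const (f u) (neighbours G u)) (allFin n))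

  -- The vertex list is an index, so that simplicity and containment become statements about that
  -- list.
  data Path : Fin n → Fin n → List (Fin n) → Set where
    stop : ∀ u → Path u u [ u ]
    _∷_ : ∀ {u v w xs} → u ~ v → Path v w xs → Path u w (u ∷ xs)

  _∷ʳ_ : ∀ {u v w xs} → Path u v xs → v ~ w → Path u w (xs ++ [ w ])
  stop u  ∷ʳ e′ = e′ ∷ stop _
  (e ∷ p) ∷ʳ e′ = e ∷ (p ∷ʳ e′)

  path-step : ∀ {u w x xs} → Path u w (x ∷ xs) →
    ∀ i → lookup (x ∷ xs) (inject₁ i) ~ lookup (x ∷ xs) (suc i)
  path-step (e ∷ stop _)       zero    = e
  path-step (e ∷ (_ ∷ _))     zero    = e
  path-step (e ∷ p@(_ ∷ _))   (suc i) = path-step p i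

  path-last : ∀ {u w x xs} → Path u w (x ∷ xs) → lookup (x ∷ xs) (fromℕ (length xs)) ≡ w
  path-last (stop _)        = refl
  path-last (_ ∷ stop _)     = refl
  path-last (_ ∷ p@(_ ∷ _)) = path-last p

  -- Since u ≢ w, the path has at least two vertices; together with x these are the three or more
  -- that `Cycle` asks for.
  closePath : ∀ {u w x xs} → Path u w xs → Unique xs → u ≢ w → x ∉ xs → x ~ u → x ~ w → ∃ (Cycle G)
  closePath (stop _) _ u≢w = contradiction refl u≢w
  closePath {x = x} p@(_∷_ {u} {xs = xs@(_ ∷ ys)} _ _) uniq u≢w x∉ x~u x~w = length ys , record
    { vertex   = lookup (x ∷ u ∷ xs)
    ; distinct = lookup-injective (All.¬Any⇒All¬ _ x∉ ∷ uniq)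
    ; step     = path-step (x~u ∷ p)
    ; close    = subst (_~ x) (sym (path-last p)) (~-sym x~w)
    }

  -- Partial trees, built up vertex by vertex. In an acyclic graph the new vertex v has exactly one neighbour in xs:
  -- a second one would close a cycle through v and a path in xs.
  data Grown : List (Fin n) → Set where
    seed : ∀ r → Grown [ r ]
    grow : ∀ {xs u v} → Grown xs → u ∈ xs → v ∉ xs → v ~ u → Grown (v ∷ xs)

  SimplePathIn : List (Fin n) → Fin n → Fin n → Set
  SimplePathIn xs u v = ∃ λ ps → Path u v ps × Unique ps × All (_∈ xs) ps

  grown-unique : ∀ {xs} → Grown xs → Unique xs
  grown-unique (seed r)         = [] ∷ []
  grown-unique (grow g _ v∉xs _) = All.¬Any⇒All¬ _ v∉xs ∷ grown-unique g

  -- Paths to the new vertex pass through the vertex it was attached to. Containment in `xs` is part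
  -- of the claim because it keeps the extended path simple: the new vertex is not in `xs`.
  grown-path : ∀ {xs} → Grown xs → ∀ {u v} → u ∈ xs → v ∈ xs → SimplePathIn xs u v
  grown-path (seed r) (here refl) (here refl) = _ , stop r , [] ∷ [] , here refl ∷ []
  grown-path (grow g x∈ y∉ e) (here refl) (here refl) = _ , stop _ , [] ∷ [] , here refl ∷ []
  grown-path (grow {v = y} g x∈ y∉ e) (here refl) (there v∈) =
    let ps , p , uniq , ⊆xs = grown-path g x∈ v∈ in
    _ , e ∷ p , All.map (λ { z∈ refl → y∉ z∈ }) ⊆xs ∷ uniq , here refl ∷ All.map there ⊆xs
  grown-path (grow {v = y} g x∈ y∉ e) (there u∈) (here refl) =
    let ps , p , uniq , ⊆xs = grown-path g u∈ x∈ in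
    _ , p ∷ʳ ~-sym e
      , Unique.++⁺ uniq ([] ∷ []) (λ { (y∈ps , here refl) → y∉ (All.lookup ⊆xs y∈ps) })
      , All.++⁺ (All.map there ⊆xs) (here refl ∷ [])
  grown-path (grow g x∈ y∉ e) (there u∈) (there v∈) =
    let ps , p , uniq , ⊆xs = grown-path g u∈ v∈ in ps , p , uniq , All.map there ⊆xs

  grown-neighbour : IsTree G → ∀ {xs u v} → Grown xs → u ∈ xs → v ∉ xs → v ~ u → ∑ (𝔸 v) xs ≡ 1
  grown-neighbour t {xs} {u} {v} g u∈ v∉ v~u =
    trans (∑-single (𝔸 v) (grown-unique g) u∈ λ {y} y∈ y≢u → 𝟙-no (v ~? y) (λ v~y → acyc y∈ y≢u v~y))
          (𝟙-yes (v ~? u) v~u)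
    where
    acyc : ∀ {y} → y ∈ xs → y ≢ u → ¬ (v ~ y)
    acyc y∈ y≢u v~y =
      let ps , p , uniq , ⊆xs = grown-path g y∈ u∈ in
      uncurry (IsTree.acyclic t) (closePath p uniq y≢u (v∉ ∘ All.lookup ⊆xs) v~y v~u)

  -- The double sum is twice the number of edges inside `xs`. A new vertex has one neighbour there,
  -- which adds 1 in its row and 1 in its column.
  grown-edges : IsTree G → ∀ {xs} → Grown xs → 2 + ∑ (λ u → ∑ (𝔸 u) xs) xs ≡ 2 * length xs
  grown-edges t (seed r) = cong (λ x → 2 + (x + 0 + 0)) (𝟙-no (r ~? r) (irrefl refl))
  grown-edges t {v ∷ xs} (grow g u∈ v∉ v~u) = begin
    2 + (𝔸 v v + ∑ (𝔸 v) xs + ∑ (λ u → 𝔸 u v + ∑ (𝔸 u) xs) xs)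
      ≡⟨ cong₂ (λ x y → 2 + (x + ∑ (𝔸 v) xs + y)) (𝟙-no (v ~? v) (irrefl refl)) (∑-+ (λ u → 𝔸 u v) _ xs) ⟩
    2 + (∑ (𝔸 v) xs + (∑ (λ u → 𝔸 u v) xs + ∑ (λ u → ∑ (𝔸 u) xs) xs))
      ≡⟨ cong₂ (λ x y → 2 + (x + (y + ∑ (λ u → ∑ (𝔸 u) xs) xs))) deg1 (trans (∑-cong (λ u → 𝔸-sym u v) xs) deg1) ⟩
    2 + (2 + ∑ (λ u → ∑ (𝔸 u) xs) xs)
      ≡⟨ cong (2 +_) (grown-edges t g) ⟩
    2 + 2 * length xs
      ≡⟨ *-suc 2 (length xs) ⟨
    2 * suc (length xs) ∎
    where
    open ≡-Reasoning
    deg1 = grown-neighbour t g u∈ v∉ v~u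

  open import Data.List.Membership.DecPropositional (Fin._≟_ {n}) using (_∈?_)

  -- The first step of the walk out of `xs` is the edge along which a partial tree grows.
  leave : ∀ {xs u v} → Star _~_ u v → u ∈ xs → v ∉ xs → ∃₂ λ x y → x ∈ xs × y ∉ xs × x ~ y
  leave ε u∈ v∉ = contradiction u∈ v∉
  leave {xs} (_◅_ {j = y} e p) u∈ v∉ with y ∈? xs
  ... | yes y∈ = leave p y∈ v∉
  ... | no  y∉ = _ , _ , u∈ , y∉ , e

  grown-nonempty : ∀ {xs} → Grown xs → ∃ (_∈ xs)
  grown-nonempty (seed r)          = r , here refl
  grown-nonempty (grow _ _ _ _) = _ , here refl

  extend : IsTree G → ∀ {xs} → Grown xs → (∀ v → v ∈ xs) ⊎ (∃ λ v → Grown (v ∷ xs))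
  extend t {xs} g with Fin.all? (_∈? xs)
  ... | yes all = inj₁ all
  ... | no ¬all =
    let v , v∉ = Fin.¬∀⟶∃¬ n _ (_∈? xs) ¬all
        u , u∈ = grown-nonempty g
        x , y , x∈ , y∉ , x~y = leave (IsTree.connected t u v) u∈ v∉
    in inj₂ (y , grow g x∈ y∉ (~-sym x~y))

  -- `go m` has either reached all vertices or collected m + 1 distinct ones; for m = n the latter
  -- contradicts the size of `Fin n`.
  grown-all : IsTree G → Fin n → ∃ λ xs → Grown xs × (∀ v → v ∈ xs)
  grown-all t r = case go n of λ where
      (xs , g , inj₁ all) → xs , g , all
      (xs , g , inj₂ len) →
        contradiction (Fin.injective⇒≤ (lookup-injective (grown-unique g))) (<⇒≱ (≤-reflexive (sym len)))
    where
    go : ∀ m → ∃ λ xs → Grown xs × ((∀ v → v ∈ xs) ⊎ length xs ≡ suc m)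
    go zero = _ , seed r , inj₂ refl
    go (suc m) with go m
    ... | xs , g , inj₁ all = xs , g , inj₁ all
    ... | xs , g , inj₂ len with extend t g
    ...   | inj₁ all      = xs , g , inj₁ all
    ...   | inj₂ (v , g′) = v ∷ xs , g′ , inj₂ (cong suc len)

  tree-degree-sum : IsTree G → 2 + ∑ (deg G) (allFin n) ≡ 2 * n
  tree-degree-sum t = begin
    2 + ∑ (deg G) V              ≡⟨ cong (2 +_) (∑-cong deg≡∑ V) ⟩
    2 + ∑ (λ u → ∑ (𝔸 u) V) V    ≡⟨ cong (2 +_) (∑-cong (λ u → sym (∑-↭ (𝔸 u) xs↭V)) V) ⟩
    2 + ∑ (λ u → ∑ (𝔸 u) xs) V   ≡⟨ cong (2 +_) (sym (∑-↭ _ xs↭V)) ⟩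
    2 + ∑ (λ u → ∑ (𝔸 u) xs) xs  ≡⟨ grown-edges t (proj₁ (proj₂ ga)) ⟩
    2 * length xs                ≡⟨ cong (2 *_) (Perm.↭-length xs↭V) ⟩
    2 * length V                 ≡⟨ cong (2 *_) (length-tabulate {n = n} (λ v → v)) ⟩
    2 * n                        ∎
    where
    open ≡-Reasoning
    V = allFin n
    ga = grown-all t (fromℕ< (IsTree.nonempty t))
    xs = proj₁ ga
    xs↭V = complete⇒↭allFin (grown-unique (proj₁ (proj₂ ga))) (proj₂ (proj₂ ga))

-- The value of σ

∈-length≤1 : ∀ {xs : List A} {x y} → length xs ≤ 1 → x ∈ xs → y ∈ xs → x ≡ y
∈-length≤1 {xs = _ ∷ []} _ (here refl) (here refl) = refl
∈-length≤1 {xs = _ ∷ _ ∷ _} (s≤s ())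

-- The degrees (du , dv) of the ends of an edge, with d the degree of the medium vertex.
data Edge (Δ d : ℕ) : ℕ → ℕ → Set where
  1–Δ : Edge Δ d 1 Δ
  2–Δ : Edge Δ d 2 Δ
  d–Δ : Edge Δ d d Δ
  d–2 : Edge Δ d d 2

EdgeType : ℕ → ℕ → ℕ → ℕ → Set
EdgeType Δ d p q = Edge Δ d p q ⊎ Edge Δ d q p

module _ {n : ℕ} (G : Graph n) where
  open Graph G using (_~_; _~?_) renaming (sym to ~-sym)

  m≡0⇒ : ∀ {i j u v} → m G i j ≡ 0 → u ~ v → deg G u ≡ i → deg G v ≢ j
  m≡0⇒ m≡0 u~v du dv with ~⇒∈-edges G u~v
  ... | inj₁ e∈ = <⇒≢ (∈-length (∈-filter⁺ _ e∈ (inj₁ (du , dv)))) (sym m≡0)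
  ... | inj₂ e∈ = <⇒≢ (∈-length (∈-filter⁺ _ e∈ (inj₂ (dv , du)))) (sym m≡0)

  deg≤1⇒≡ : ∀ {u v w} → deg G u ≤ 1 → u ~ v → u ~ w → v ≡ w
  deg≤1⇒≡ du u~v u~w = ∈-length≤1 du (∈-neighbours⁺ G u~v) (∈-neighbours⁺ G u~w)

  -- If all neighbours of v had degree at most 1, then v together with its neighbours would be
  -- closed under adjacency. By connectedness w would be v or one of these neighbours.
  nonLeafNeighbour : IsTree G → ∀ {v w} → v ≢ w → 1 < deg G w → ∃ λ x → v ~ x × 1 < deg G x
  nonLeafNeighbour t {v} {w} v≢w dw with Fin.any? (λ x → (v ~? x) ×-dec (1 <? deg G x))
  ... | yes x = x
  ... | no ∄x with closed (inj₁ refl) (IsTree.connected t v w)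
    where
    closed : ∀ {x y} → v ≡ x ⊎ v ~ x → Star _~_ x y → v ≡ y ⊎ v ~ y
    closed x∈ ε = x∈
    closed (inj₁ refl) (e ◅ p) = closed (inj₂ e) p
    closed {x} (inj₂ v~x) (e ◅ p) =
      closed (inj₁ (deg≤1⇒≡ (≮⇒≥ λ dx → ∄x (x , v~x , dx)) (~-sym v~x) e)) p
  ...   | inj₁ v≡w = contradiction v≡w v≢w
  ...   | inj₂ v~w = contradiction (w , v~w , dw) ∄x

module Family {n Δ j : ℕ} (G : Graph n) (fam : G ∈𝒯‴[ Δ , j ]) where
  open Graph G using (_~_) renaming (sym to ~-sym)
  open _∈𝒯‴[_,_] fam

  V = allFin n
  d = j + 1

  3≤d : 3 ≤ d
  3≤d = subst (3 ≤_) w-degree (proj₁ w-medium)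

  d<Δ : d < Δ
  d<Δ = subst (_< Δ) w-degree (proj₂ w-medium)

  1<Δ : 1 < Δ
  1<Δ = ≤-trans (s≤s (s≤s z≤n)) (≤-trans 3≤d (<⇒≤ d<Δ))

  2<Δ : 2 < Δ
  2<Δ = ≤-trans 3≤d (<⇒≤ d<Δ)

  1<w : 1 < deg G w
  1<w = <⇒≤ (proj₁ w-medium)

  ⟦_≟_⟧ : ℕ → ℕ → ℕ
  ⟦ p ≟ q ⟧ = 𝟙 (p ℕ.≟ q)

  ≡⇒1 : ∀ {p q} → p ≡ q → ⟦ p ≟ q ⟧ ≡ 1
  ≡⇒1 = 𝟙-yes (_ ℕ.≟ _)

  <⇒0 : ∀ {p q} → p < q → ⟦ p ≟ q ⟧ ≡ 0
  <⇒0 p<q = 𝟙-no (_ ℕ.≟ _) (<⇒≢ p<q)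

  >⇒0 : ∀ {p q} → q < p → ⟦ p ≟ q ⟧ ≡ 0
  >⇒0 q<p = 𝟙-no (_ ℕ.≟ _) (>⇒≢ q<p)

  -- Condition (4) accounts for j + 1 neighbours, which is the whole degree of w. As 2 and Δ differ,
  -- `c` is at most 1, so the defects `1 ∸ c v` add up to 0 and each of them vanishes.
  w-neighbours : ∀ {u} → w ~ u → deg G u ≡ 2 ⊎ deg G u ≡ Δ
  w-neighbours {u} w~u = 2-or-Δ (deg G u) rest≡0
    where
    open ≡-Reasoning
    N = neighbours G w
    c : Fin n → ℕ
    c v = ⟦ deg G v ≟ 2 ⟧ + ⟦ deg G v ≟ Δ ⟧
    c≤1 : ∀ v → c v ≤ 1
    c≤1 v = helper (deg G v)
      where
      helper : ∀ p → ⟦ p ≟ 2 ⟧ + ⟦ p ≟ Δ ⟧ ≤ 1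
      helper p = case p ℕ.≟ 2 of λ where
        (yes refl) → ≤-reflexive (cong (1 +_) (<⇒0 2<Δ))
        (no p≢2)   → subst (λ x → x + ⟦ p ≟ Δ ⟧ ≤ 1) (sym (𝟙-no (p ℕ.≟ 2) p≢2)) (𝟙≤1 (p ℕ.≟ Δ))
    rest≡0 : 1 ∸ c u ≡ 0
    rest≡0 = n≤0⇒n≡0 (subst (1 ∸ c u ≤_) ∑rest≡0 (∈⇒≤∑ (λ v → 1 ∸ c v) (∈-neighbours⁺ G w~u)))
      where
      ∑c≡d : ∑ c N ≡ j + 1
      ∑c≡d = begin
        ∑ c N
          ≡⟨ ∑-+ _ _ N ⟩
        ∑ (λ v → ⟦ deg G v ≟ 2 ⟧) N + ∑ (λ v → ⟦ deg G v ≟ Δ ⟧) N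
          ≡⟨ cong₂ _+_ (sym (length-filter≡∑ (λ v → deg G v ℕ.≟ 2) N))
                      (sym (length-filter≡∑ (λ v → deg G v ℕ.≟ Δ) N)) ⟩
        neighboursOfDegree G 2 w + neighboursOfDegree G Δ w
          ≡⟨ cong₂ _+_ w-neighbours-2 w-neighbours-Δ ⟩
        j + 1 ∎
      ∑rest≡0 : ∑ (λ v → 1 ∸ c v) N ≡ 0
      ∑rest≡0 = +-cancelˡ-≡ (j + 1) _ _ (begin
        j + 1 + ∑ (λ v → 1 ∸ c v) N   ≡⟨ cong (_+ ∑ (λ v → 1 ∸ c v) N) (sym ∑c≡d) ⟩
        ∑ c N + ∑ (λ v → 1 ∸ c v) N   ≡⟨ ∑-+ _ _ N ⟨
        ∑ (λ v → c v + (1 ∸ c v)) N   ≡⟨ ∑-cong (λ v → m+[n∸m]≡n (c≤1 v)) N ⟩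
        ∑ (λ _ → 1) N                 ≡⟨ length≡∑ N ⟨
        deg G w                       ≡⟨ w-degree ⟩
        j + 1                         ≡⟨ +-identityʳ _ ⟨
        j + 1 + 0                     ∎)
    2-or-Δ : ∀ p → 1 ∸ (⟦ p ≟ 2 ⟧ + ⟦ p ≟ Δ ⟧) ≡ 0 → p ≡ 2 ⊎ p ≡ Δ
    2-or-Δ p eq with p ℕ.≟ 2 | p ℕ.≟ Δ
    ... | yes p≡2 | _       = inj₁ p≡2
    ... | no _    | yes p≡Δ = inj₂ p≡Δ
    ... | no p≢2  | no p≢Δ  = contradiction
      (trans (sym eq) (cong₂ (λ x y → 1 ∸ (x + y)) (𝟙-no (p ℕ.≟ 2) p≢2) (𝟙-no (p ℕ.≟ Δ) p≢Δ))) λ ()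

  data Class (v : Fin n) : Set where
    medium : v ≡ w → Class v
    leaf   : v ≢ w → deg G v ≡ 1 → Class v
    two    : v ≢ w → deg G v ≡ 2 → Class v
    big    : v ≢ w → deg G v ≡ Δ → Class v

  class : ∀ v → Class v
  class v with v Fin.≟ w
  ... | yes v≡w = medium v≡w
  ... | no  v≢w with other-degrees v v≢w
  ...   | inj₁ d1        = leaf v≢w d1
  ...   | inj₂ (inj₁ d2) = two v≢w d2
  ...   | inj₂ (inj₂ dΔ) = big v≢w dΔ

  -- The neighbour v is not w, whose neighbours have degree 2 or Δ, and not a leaf, since it has a
  -- neighbour of degree greater than 1. Degree 2 is where condition (1) enters.
  leaf-neighbour : ∀ {u v} → u ~ v → deg G u ≡ 1 → deg G v ≡ Δ
  leaf-neighbour {u} {v} u~v du with class v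
  ... | medium refl with w-neighbours (~-sym u~v)
  ...   | inj₁ du′ = contradiction (trans (sym du) du′) λ ()
  ...   | inj₂ du′ = contradiction (trans (sym du) du′) (<⇒≢ 1<Δ)
  leaf-neighbour {u} {v} u~v du | big _ dv = dv
  leaf-neighbour {u} {v} u~v du | leaf v≢w dv =
    let x , v~x , dx = nonLeafNeighbour G isTree v≢w 1<w in
    contradiction (trans (cong (deg G) (deg≤1⇒≡ G (≤-reflexive dv) v~x (~-sym u~v))) du) (>⇒≢ dx)
  leaf-neighbour {u} {v} u~v du | two v≢w dv =
    let x , v~x , dx = nonLeafNeighbour G isTree v≢w 1<w in
    -- Of the two neighbours of v, the leaf u drops out of the filter and x stays, so v is an
    -- internal leaf; condition (1) then gives the goal itself.
    internalLeaves v (≤-reflexive (sym dv) , ≤-antisym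
      (≤-pred (subst (length (filter (λ y → 1 <? deg G y) (neighbours G v)) <_) dv
        (filter-notAll (λ y → 1 <? deg G y) _
        (lose (∈-neighbours⁺ G (~-sym u~v)) (λ 1<du → <⇒≢ 1<du (sym du))))))
      (filter-some (λ y → 1 <? deg G y) (lose (∈-neighbours⁺ G v~x) dx)))

  edge : ∀ {p q} {u v} → Edge Δ d p q → deg G u ≡ p → deg G v ≡ q → Edge Δ d (deg G u) (deg G v)
  edge e refl refl = e

  edge-type : ∀ {u v} → u ~ v → EdgeType Δ d (deg G u) (deg G v)
  edge-type {u} {v} u~v with class u | class v
  ... | medium refl | _ = inj₁ ([ edge d–2 w-degree , edge d–Δ w-degree ]′ (w-neighbours u~v))
  ... | leaf _ du | _   = inj₁ (edge 1–Δ du (leaf-neighbour u~v du))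
  ... | _ | medium refl = inj₂ ([ edge d–2 w-degree , edge d–Δ w-degree ]′ (w-neighbours (~-sym u~v)))
  ... | _ | leaf _ dv   = inj₂ (edge 1–Δ dv (leaf-neighbour (~-sym u~v) dv))
  ... | two _ du | two _ dv = contradiction dv (m≡0⇒ G m₂₂≡0 u~v du)
  ... | two _ du | big _ dv = inj₁ (edge 2–Δ du dv)
  ... | big _ du | two _ dv = inj₂ (edge 2–Δ dv du)
  ... | big _ du | big _ dv = contradiction dv (m≡0⇒ G mΔΔ≡0 u~v du)

  -- Sums by degree class and by edge type

  N : ℕ → ℕ
  N c = ∑ (λ u → ⟦ deg G u ≟ c ⟧) V

  -- Each value of ψ is expanded in the indicators of the four classes. The medium class is the
  -- single vertex w, so `ψ d` appears without a counting factor.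
  ∑-degrees : ∀ ψ → ∑ (ψ ∘ deg G) V ≡ ψ 1 * N 1 + ψ 2 * N 2 + ψ Δ * N Δ + ψ d
  ∑-degrees ψ = begin
    ∑ (ψ ∘ deg G) V
      ≡⟨ ∑-cong pointwise V ⟩
    ∑ (λ u → ψ 1 * ⟦ deg G u ≟ 1 ⟧ + ψ 2 * ⟦ deg G u ≟ 2 ⟧ + ψ Δ * ⟦ deg G u ≟ Δ ⟧ + ψ d * isw u) V
      ≡⟨ ∑-+ _ _ V ⟩
    ∑ (λ u → ψ 1 * ⟦ deg G u ≟ 1 ⟧ + ψ 2 * ⟦ deg G u ≟ 2 ⟧ + ψ Δ * ⟦ deg G u ≟ Δ ⟧) V + ∑ (λ u → ψ d * isw u) V
      ≡⟨ cong (_+ ∑ (λ u → ψ d * isw u) V)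
           (trans (∑-+ _ _ V) (cong (_+ ∑ (λ u → ψ Δ * ⟦ deg G u ≟ Δ ⟧) V) (∑-+ _ _ V))) ⟩
    ∑ (λ u → ψ 1 * ⟦ deg G u ≟ 1 ⟧) V + ∑ (λ u → ψ 2 * ⟦ deg G u ≟ 2 ⟧) V + ∑ (λ u → ψ Δ * ⟦ deg G u ≟ Δ ⟧) V
      + ∑ (λ u → ψ d * isw u) V
      ≡⟨ cong₂ _+_ (cong₂ _+_ (cong₂ _+_ (∑-* (ψ 1) (λ u → ⟦ deg G u ≟ 1 ⟧) V) (∑-* (ψ 2) (λ u → ⟦ deg G u ≟ 2 ⟧) V))
                              (∑-* (ψ Δ) (λ u → ⟦ deg G u ≟ Δ ⟧) V)) (∑-* (ψ d) isw V) ⟩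
    ψ 1 * N 1 + ψ 2 * N 2 + ψ Δ * N Δ + ψ d * ∑ isw V
      ≡⟨ cong (λ x → ψ 1 * N 1 + ψ 2 * N 2 + ψ Δ * N Δ + ψ d * x)
           (trans (∑-single isw (Unique.allFin⁺ n) (∈-allFin w) (λ {u} _ u≢w → 𝟙-no (u Fin.≟ w) u≢w))
                  (𝟙-yes (w Fin.≟ w) refl)) ⟩
    ψ 1 * N 1 + ψ 2 * N 2 + ψ Δ * N Δ + ψ d * 1
      ≡⟨ cong (ψ 1 * N 1 + ψ 2 * N 2 + ψ Δ * N Δ +_) (*-identityʳ (ψ d)) ⟩
    ψ 1 * N 1 + ψ 2 * N 2 + ψ Δ * N Δ + ψ d ∎
    where
    open ≡-Reasoning
    isw : Fin n → ℕ
    isw u = 𝟙 (u Fin.≟ w)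
    table : ∀ p u {a b c e} → ⟦ p ≟ 1 ⟧ ≡ a → ⟦ p ≟ 2 ⟧ ≡ b → ⟦ p ≟ Δ ⟧ ≡ c → isw u ≡ e →
      ψ 1 * a + ψ 2 * b + ψ Δ * c + ψ d * e ≡
      ψ 1 * ⟦ p ≟ 1 ⟧ + ψ 2 * ⟦ p ≟ 2 ⟧ + ψ Δ * ⟦ p ≟ Δ ⟧ + ψ d * isw u
    table _ _ refl refl refl refl = refl
    e₁ : ∀ a b c d → a ≡ a * 1 + b * 0 + c * 0 + d * 0
    e₁ = solve-∀
    e₂ : ∀ a b c d → b ≡ a * 0 + b * 1 + c * 0 + d * 0
    e₂ = solve-∀
    e₃ : ∀ a b c d → c ≡ a * 0 + b * 0 + c * 1 + d * 0
    e₃ = solve-∀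
    e₄ : ∀ a b c d → d ≡ a * 0 + b * 0 + c * 0 + d * 1
    e₄ = solve-∀
    pointwise : ∀ u → ψ (deg G u) ≡
      ψ 1 * ⟦ deg G u ≟ 1 ⟧ + ψ 2 * ⟦ deg G u ≟ 2 ⟧ + ψ Δ * ⟦ deg G u ≟ Δ ⟧ + ψ d * isw u
    pointwise u with class u
    ... | medium refl rewrite w-degree =
      trans (e₄ (ψ 1) (ψ 2) (ψ Δ) (ψ d))
            (table d u (>⇒0 (≤-trans (s≤s (s≤s z≤n)) 3≤d)) (>⇒0 3≤d) (<⇒0 d<Δ) (𝟙-yes (u Fin.≟ w) refl))
    ... | leaf u≢w du rewrite du =
      trans (e₁ (ψ 1) (ψ 2) (ψ Δ) (ψ d)) (table 1 u refl refl (<⇒0 1<Δ) (𝟙-no (u Fin.≟ w) u≢w))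
    ... | two u≢w du rewrite du =
      trans (e₂ (ψ 1) (ψ 2) (ψ Δ) (ψ d)) (table 2 u refl refl (<⇒0 2<Δ) (𝟙-no (u Fin.≟ w) u≢w))
    ... | big u≢w du rewrite du =
      trans (e₃ (ψ 1) (ψ 2) (ψ Δ) (ψ d)) (table Δ u (>⇒0 1<Δ) (>⇒0 2<Δ) (≡⇒1 {Δ} refl) (𝟙-no (u Fin.≟ w) u≢w))

  -- `edges` orders the ends of an edge by vertex number and `Edge` by degree class; symmetry of f
  -- and g reconciles the two.
  ∑-edge-type : ∀ {f g : ℕ → ℕ → ℕ} → (∀ p q → f p q ≡ f q p) → (∀ p q → g p q ≡ g q p) →
    (∀ {p q} → Edge Δ d p q → f p q ≡ g p q) →
    ∑ (λ (u , v) → f (deg G u) (deg G v)) (edges G) ≡ ∑ (λ (u , v) → g (deg G u) (deg G v)) (edges G)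
  ∑-edge-type f-sym g-sym eq = ∑-cong-∈ (edges G) λ {(u , v)} e∈ → case edge-type (∈-edges⁻ G e∈) of λ where
    (inj₁ e) → eq e
    (inj₂ e) → trans (f-sym _ _) (trans (eq e) (g-sym _ _))

  -- χ marks the edges between w and its neighbours of degree 2, the only ones without an end of degree Δ.
  χ : ℕ → ℕ → ℕ
  χ p q = ⟦ p ≟ d ⟧ * ⟦ q ≟ 2 ⟧ + ⟦ q ≟ d ⟧ * ⟦ p ≟ 2 ⟧

  -- As a sum over ordered adjacent pairs, only the row of w survives, because no other vertex has
  -- degree d. That row counts the neighbours of w of degree 2.
  ∑χ≡j : ∑ (λ (u , v) → χ (deg G u) (deg G v)) (edges G) ≡ j
  ∑χ≡j = begin
    ∑ (λ (u , v) → χ (deg G u) (deg G v)) (edges G)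
      ≡⟨ ∑-edges G (λ u v → ⟦ deg G u ≟ d ⟧ * ⟦ deg G v ≟ 2 ⟧) ⟩
    ∑ (λ u → ∑ (λ v → ⟦ deg G u ≟ d ⟧ * ⟦ deg G v ≟ 2 ⟧) (neighbours G u)) V
      ≡⟨ ∑-cong (λ u → ∑-* ⟦ deg G u ≟ d ⟧ _ (neighbours G u)) V ⟩
    ∑ (λ u → ⟦ deg G u ≟ d ⟧ * ∑ (λ v → ⟦ deg G v ≟ 2 ⟧) (neighbours G u)) V
      ≡⟨ ∑-single _ (Unique.allFin⁺ n) (∈-allFin w)
           (λ {u} _ u≢w → cong (_* ∑ (λ v → ⟦ deg G v ≟ 2 ⟧) (neighbours G u)) (other u≢w)) ⟩
    ⟦ deg G w ≟ d ⟧ * ∑ (λ v → ⟦ deg G v ≟ 2 ⟧) (neighbours G w)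
      ≡⟨ cong₂ _*_ (≡⇒1 w-degree) (sym (length-filter≡∑ (λ v → deg G v ℕ.≟ 2) (neighbours G w))) ⟩
    1 * neighboursOfDegree G 2 w
      ≡⟨ trans (*-identityˡ _) w-neighbours-2 ⟩
    j ∎
    where
    open ≡-Reasoning
    other : ∀ {u} → u ≢ w → ⟦ deg G u ≟ d ⟧ ≡ 0
    other {u} u≢w with other-degrees u u≢w
    ... | inj₁ d1        = trans (cong ⟦_≟ d ⟧ d1) (<⇒0 (≤-trans (s≤s (s≤s z≤n)) 3≤d))
    ... | inj₂ (inj₁ d2) = trans (cong ⟦_≟ d ⟧ d2) (<⇒0 3≤d)
    ... | inj₂ (inj₂ dΔ) = trans (cong ⟦_≟ d ⟧ dΔ) (>⇒0 d<Δ)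

  χ-sym : ∀ p q → χ p q ≡ χ q p
  χ-sym p q = +-comm (⟦ p ≟ d ⟧ * ⟦ q ≟ 2 ⟧) _

  χ-1Δ : χ 1 Δ ≡ 0
  χ-1Δ rewrite >⇒0 2<Δ | >⇒0 d<Δ = cong (_+ 0) (*-zeroʳ ⟦ 1 ≟ d ⟧)

  χ-2Δ : χ 2 Δ ≡ 0
  χ-2Δ rewrite >⇒0 2<Δ | >⇒0 d<Δ = cong (_+ 0) (*-zeroʳ ⟦ 2 ≟ d ⟧)

  χ-dΔ : χ d Δ ≡ 0
  χ-dΔ rewrite >⇒0 2<Δ | >⇒0 d<Δ = cong (_+ 0) (*-zeroʳ ⟦ d ≟ d ⟧)

  χ-d2 : χ d 2 ≡ 1
  χ-d2 rewrite ≡⇒1 {d} refl | <⇒0 3≤d = refl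

  big-end : ∀ {p q} → Edge Δ d p q → ⟦ p ≟ Δ ⟧ + ⟦ q ≟ Δ ⟧ + χ p q ≡ 1
  big-end 1–Δ rewrite χ-1Δ | <⇒0 1<Δ | ≡⇒1 {Δ} refl = refl
  big-end 2–Δ rewrite χ-2Δ | <⇒0 2<Δ | ≡⇒1 {Δ} refl = refl
  big-end d–Δ rewrite χ-dΔ | <⇒0 d<Δ | ≡⇒1 {Δ} refl = refl
  big-end d–2 rewrite χ-d2 | <⇒0 d<Δ | <⇒0 2<Δ = refl

  α β γ : ℕ
  α = ∣ 1 - Δ ∣ ^ 2
  β = ∣ 2 - Δ ∣ ^ 2
  γ = ∣ d - Δ ∣ ^ 2

  φ : ℕ → ℕ
  φ p = α * ⟦ p ≟ 1 ⟧ + β * ⟦ p ≟ 2 ⟧ + γ * ⟦ p ≟ d ⟧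

  φ1 : φ 1 ≡ α
  φ1 rewrite <⇒0 (≤-trans (s≤s (s≤s z≤n)) 3≤d) = lemma α β γ
    where
    lemma : ∀ a b c → a * 1 + b * 0 + c * 0 ≡ a
    lemma = solve-∀

  φ2 : φ 2 ≡ β
  φ2 rewrite <⇒0 3≤d = lemma α β γ
    where
    lemma : ∀ a b c → a * 0 + b * 1 + c * 0 ≡ b
    lemma = solve-∀

  φd : φ d ≡ γ
  φd rewrite >⇒0 (≤-trans (s≤s (s≤s z≤n)) 3≤d) | >⇒0 3≤d | ≡⇒1 {d} refl = lemma α β γ
    where
    lemma : ∀ a b c → a * 0 + b * 0 + c * 1 ≡ c
    lemma = solve-∀

  φΔ : φ Δ ≡ 0
  φΔ rewrite >⇒0 1<Δ | >⇒0 2<Δ | >⇒0 d<Δ = lemma α β γ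
    where
    lemma : ∀ a b c → a * 0 + b * 0 + c * 0 ≡ 0
    lemma = solve-∀

  unmarked : ∀ a b c → a + b * 0 ≡ a + 0 + c * 0
  unmarked = solve-∀

  -- On a marked edge the value is (d - 2)² while φ gives γ + β; each of the two is added to the
  -- side of the other, which avoids subtraction.
  potential : ∀ {p q} → Edge Δ d p q →
    ∣ p - q ∣ ^ 2 + (γ + β) * χ p q ≡ φ p + φ q + ∣ d - 2 ∣ ^ 2 * χ p q
  potential 1–Δ rewrite χ-1Δ | φ1 | φΔ = unmarked α (γ + β) (∣ d - 2 ∣ ^ 2)
  potential 2–Δ rewrite χ-2Δ | φ2 | φΔ = unmarked β (γ + β) (∣ d - 2 ∣ ^ 2)
  potential d–Δ rewrite χ-dΔ | φd | φΔ = unmarked γ (γ + β) (∣ d - 2 ∣ ^ 2)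
  potential d–2 rewrite χ-d2 | φd | φ2 = lemma (∣ d - 2 ∣ ^ 2) (γ + β)
    where
    lemma : ∀ a b → a + b * 1 ≡ b + a * 1
    lemma = solve-∀

  E = length (edges G)

  ∑deg≡2E : ∑ (deg G) V ≡ E + E
  ∑deg≡2E = begin
    ∑ (deg G) V                 ≡⟨ ∑-cong (λ u → sym (*-identityʳ (deg G u))) V ⟩
    ∑ (λ u → deg G u * 1) V     ≡⟨ ∑-edges-endpoints G (λ _ → 1) ⟨
    ∑ (λ _ → 2) (edges G)       ≡⟨ ∑-+ (λ _ → 1) (λ _ → 1) (edges G) ⟩
    ∑ (λ _ → 1) (edges G) + ∑ (λ _ → 1) (edges G) ≡⟨ cong₂ _+_ (length≡∑ (edges G)) (length≡∑ (edges G)) ⟨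
    E + E                       ∎
    where open ≡-Reasoning

  E+1≡n : E + 1 ≡ n
  E+1≡n = *-cancelˡ-≡ _ _ 2 (trans (lemma E) (trans (cong (2 +_) (sym ∑deg≡2E)) (tree-degree-sum G isTree)))
    where
    lemma : ∀ e → 2 * (e + 1) ≡ 2 + (e + e)
    lemma = solve-∀

  ΔN+j≡E : Δ * N Δ + j ≡ E
  ΔN+j≡E = begin
    Δ * N Δ + j
      ≡⟨ cong₂ _+_ eq (sym ∑χ≡j) ⟩
    ∑ (λ (u , v) → ⟦ deg G u ≟ Δ ⟧ + ⟦ deg G v ≟ Δ ⟧) (edges G) + ∑ (λ (u , v) → χ (deg G u) (deg G v)) (edges G)
      ≡⟨ ∑-+ _ _ (edges G) ⟨
    ∑ (λ (u , v) → ⟦ deg G u ≟ Δ ⟧ + ⟦ deg G v ≟ Δ ⟧ + χ (deg G u) (deg G v)) (edges G)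
      ≡⟨ ∑-edge-type {λ p q → ⟦ p ≟ Δ ⟧ + ⟦ q ≟ Δ ⟧ + χ p q} {λ _ _ → 1}
           (λ p q → cong₂ _+_ (+-comm ⟦ p ≟ Δ ⟧ _) (χ-sym p q)) (λ _ _ → refl) big-end ⟩
    ∑ (λ _ → 1) (edges G)
      ≡⟨ length≡∑ (edges G) ⟨
    E ∎
    where
    open ≡-Reasoning
    eq : Δ * N Δ ≡ ∑ (λ (u , v) → ⟦ deg G u ≟ Δ ⟧ + ⟦ deg G v ≟ Δ ⟧) (edges G)
    eq = begin
      Δ * N Δ
        ≡⟨ lemma (N 1) (N 2) (Δ * N Δ) d ⟨
      1 * 0 * N 1 + 2 * 0 * N 2 + Δ * N Δ + d * 0
        ≡⟨ cong₂ _+_ (cong₂ _+_ (cong₂ (λ x y → 1 * x * N 1 + 2 * y * N 2) (sym (<⇒0 1<Δ)) (sym (<⇒0 2<Δ)))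
                                (cong (_* N Δ) (trans (sym (*-identityʳ Δ)) (cong (Δ *_) (sym (≡⇒1 {Δ} refl))))))
                     (cong (d *_) (sym (<⇒0 d<Δ))) ⟩
      1 * ⟦ 1 ≟ Δ ⟧ * N 1 + 2 * ⟦ 2 ≟ Δ ⟧ * N 2 + Δ * ⟦ Δ ≟ Δ ⟧ * N Δ + d * ⟦ d ≟ Δ ⟧
        ≡⟨ ∑-degrees (λ p → p * ⟦ p ≟ Δ ⟧) ⟨
      ∑ (λ u → deg G u * ⟦ deg G u ≟ Δ ⟧) V
        ≡⟨ ∑-edges-endpoints G (λ u → ⟦ deg G u ≟ Δ ⟧) ⟨
      ∑ (λ (u , v) → ⟦ deg G u ≟ Δ ⟧ + ⟦ deg G v ≟ Δ ⟧) (edges G) ∎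
      where
      lemma : ∀ a b c d → 1 * 0 * a + 2 * 0 * b + c + d * 0 ≡ c
      lemma = solve-∀

  n≡ : n ≡ N 1 + N 2 + N Δ + 1
  n≡ = begin
    n                                           ≡⟨ length-tabulate {n = n} (λ v → v) ⟨
    length V                                    ≡⟨ length≡∑ V ⟩
    ∑ (λ _ → 1) V                               ≡⟨ ∑-degrees (λ _ → 1) ⟩
    1 * N 1 + 1 * N 2 + 1 * N Δ + 1             ≡⟨ lemma (N 1) (N 2) (N Δ) ⟩
    N 1 + N 2 + N Δ + 1                         ∎
    where
    open ≡-Reasoning
    lemma : ∀ a b c → 1 * a + 1 * b + 1 * c + 1 ≡ a + b + c + 1
    lemma = solve-∀

  2E≡ : E + E ≡ 1 * N 1 + 2 * N 2 + Δ * N Δ + d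
  2E≡ = trans (sym ∑deg≡2E) (∑-degrees (λ p → p))

  -- The sum of `potential` over all edges; `N Δ` drops out since φ vanishes at Δ.
  σ≡ : σ G + (γ + β) * j ≡ α * N 1 + 2 * β * N 2 + d * γ + ∣ d - 2 ∣ ^ 2 * j
  σ≡ = begin
    σ G + (γ + β) * j
      ≡⟨ cong (λ x → σ G + (γ + β) * x) ∑χ≡j ⟨
    σ G + (γ + β) * ∑ (λ (u , v) → χ (deg G u) (deg G v)) (edges G)
      ≡⟨ cong (σ G +_) (∑-* (γ + β) _ (edges G)) ⟨
    σ G + ∑ (λ (u , v) → (γ + β) * χ (deg G u) (deg G v)) (edges G)
      ≡⟨ ∑-+ _ _ (edges G) ⟨
    ∑ (λ (u , v) → ∣ deg G u - deg G v ∣ ^ 2 + (γ + β) * χ (deg G u) (deg G v)) (edges G)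
      ≡⟨ ∑-edge-type {λ p q → ∣ p - q ∣ ^ 2 + (γ + β) * χ p q} {λ p q → φ p + φ q + ∣ d - 2 ∣ ^ 2 * χ p q}
           (λ p q → cong₂ (λ x y → x ^ 2 + (γ + β) * y) (∣-∣-comm p q) (χ-sym p q))
           (λ p q → cong₂ (λ x y → x + ∣ d - 2 ∣ ^ 2 * y) (+-comm (φ p) (φ q)) (χ-sym p q)) potential ⟩
    ∑ (λ (u , v) → φ (deg G u) + φ (deg G v) + ∣ d - 2 ∣ ^ 2 * χ (deg G u) (deg G v)) (edges G)
      ≡⟨ ∑-+ _ _ (edges G) ⟩
    ∑ (λ (u , v) → φ (deg G u) + φ (deg G v)) (edges G)
      + ∑ (λ (u , v) → ∣ d - 2 ∣ ^ 2 * χ (deg G u) (deg G v)) (edges G)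
      ≡⟨ cong₂ _+_ (∑-edges-endpoints G (φ ∘ deg G))
                  (trans (∑-* (∣ d - 2 ∣ ^ 2) (λ (u , v) → χ (deg G u) (deg G v)) (edges G))
                         (cong (∣ d - 2 ∣ ^ 2 *_) ∑χ≡j)) ⟩
    ∑ (λ u → deg G u * φ (deg G u)) V + ∣ d - 2 ∣ ^ 2 * j
      ≡⟨ cong (_+ _) (∑-degrees (λ p → p * φ p)) ⟩
    1 * φ 1 * N 1 + 2 * φ 2 * N 2 + Δ * φ Δ * N Δ + d * φ d + ∣ d - 2 ∣ ^ 2 * j
      ≡⟨ cong (_+ ∣ d - 2 ∣ ^ 2 * j) eval ⟩
    α * N 1 + 2 * β * N 2 + d * γ + ∣ d - 2 ∣ ^ 2 * j ∎
    where
    open ≡-Reasoning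
    lemma : ∀ a x b y δ z g → 1 * a * x + 2 * b * y + δ * 0 * z + g ≡ a * x + 2 * b * y + g
    lemma = solve-∀
    eval : 1 * φ 1 * N 1 + 2 * φ 2 * N 2 + Δ * φ Δ * N Δ + d * φ d ≡ α * N 1 + 2 * β * N 2 + d * γ
    eval rewrite φ1 | φ2 | φΔ | φd = lemma α (N 1) β (N 2) Δ (N Δ) (d * γ)

σ-determined : ∀ {n Δ j} (T T′ : Graph n) → T ∈𝒯‴[ Δ , j ] → T′ ∈𝒯‴[ Δ , j ] → σ T ≡ σ T′
σ-determined {n} {Δ} {j} T T′ t t′ = +-cancelʳ-≡ ((A.γ + A.β) * j) _ _ (begin
  σ T + (A.γ + A.β) * j
    ≡⟨ A.σ≡ ⟩
  A.α * A.N 1 + 2 * A.β * A.N 2 + A.d * A.γ + ∣ A.d - 2 ∣ ^ 2 * j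
    ≡⟨ cong₂ (λ x y → A.α * x + 2 * A.β * y + A.d * A.γ + ∣ A.d - 2 ∣ ^ 2 * j) N1≡ N2≡ ⟩
  A.α * B.N 1 + 2 * A.β * B.N 2 + A.d * A.γ + ∣ A.d - 2 ∣ ^ 2 * j
    -- The constants α, β, γ and d depend only on Δ and j, so those of `A` and `B` agree
    -- definitionally.
    ≡⟨ B.σ≡ ⟨
  σ T′ + (A.γ + A.β) * j ∎)
  where
  open ≡-Reasoning
  module A = Family T t
  module B = Family T′ t′
  E≡ : A.E ≡ B.E
  E≡ = +-cancelʳ-≡ 1 _ _ (trans A.E+1≡n (sym B.E+1≡n))
  NΔ≡ : A.N Δ ≡ B.N Δ
  NΔ≡ = *-cancelˡ-≡ _ _ Δ {{ℕ.>-nonZero (≤-trans (s≤s z≤n) A.1<Δ)}}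
          (+-cancelʳ-≡ j _ _ (trans A.ΔN+j≡E (trans E≡ (sym B.ΔN+j≡E))))
  small≡ : A.N 1 + A.N 2 ≡ B.N 1 + B.N 2
  small≡ = +-cancelʳ-≡ (A.N Δ) _ _ (+-cancelʳ-≡ 1 _ _
    (trans (sym A.n≡) (trans B.n≡ (cong (λ x → B.N 1 + B.N 2 + x + 1) (sym NΔ≡)))))
  degrees≡ : 1 * A.N 1 + 2 * A.N 2 ≡ 1 * B.N 1 + 2 * B.N 2
  degrees≡ = +-cancelʳ-≡ (Δ * A.N Δ) _ _ (+-cancelʳ-≡ A.d _ _
    (trans (sym A.2E≡) (trans (cong₂ _+_ E≡ E≡)
      (trans B.2E≡ (cong (λ x → 1 * B.N 1 + 2 * B.N 2 + Δ * x + B.d) (sym NΔ≡))))))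
  split : ∀ a b → a + b + b ≡ 1 * a + 2 * b
  split = solve-∀
  -- N₂ is the excess of N₁ + 2 N₂ over N₁ + N₂.
  N2≡ : A.N 2 ≡ B.N 2
  N2≡ = +-cancelˡ-≡ (A.N 1 + A.N 2) _ _ (begin
    A.N 1 + A.N 2 + A.N 2 ≡⟨ split (A.N 1) (A.N 2) ⟩
    1 * A.N 1 + 2 * A.N 2 ≡⟨ degrees≡ ⟩
    1 * B.N 1 + 2 * B.N 2 ≡⟨ split (B.N 1) (B.N 2) ⟨
    B.N 1 + B.N 2 + B.N 2 ≡⟨ cong (_+ B.N 2) small≡ ⟨
    A.N 1 + A.N 2 + B.N 2 ∎)
  N1≡ : A.N 1 ≡ B.N 1
  N1≡ = +-cancelʳ-≡ (A.N 2) _ _ (trans small≡ (cong (B.N 1 +_) (sym N2≡)))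

-- A tree of the family

-- In the constructed tree the children of a vertex, its parent and the neighbours of w of a given
-- degree all fill intervals of numbers, so every count there reduces to this one.
∑-interval : ∀ n a c → a + c ≤ n → {P : Pred (Fin n) 0ℓ} (P? : Decidable₁ P) →
  (∀ i → P i → a ≤ toℕ i × toℕ i < a + c) → (∀ i → a ≤ toℕ i → toℕ i < a + c → P i) →
  ∑ (𝟙 ∘ P?) (allFin n) ≡ c
∑-interval zero    zero zero    _    P? to from = refl
∑-interval (suc n) a    c       a+c≤ P? to from = trans (cong (𝟙 (P? zero) +_) tail) (split a c a+c≤ P? to from)
  where
  tail : ∑ (𝟙 ∘ P?) (tabulate suc) ≡ ∑ (𝟙 ∘ P? ∘ suc) (allFin n)
  tail = trans (cong (∑ (𝟙 ∘ P?)) (sym (map-tabulate (λ x → x) suc))) (∑-map (𝟙 ∘ P?) suc (allFin n))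
  split : ∀ a c → a + c ≤ suc n → {P : Pred (Fin (suc n)) 0ℓ} (P? : Decidable₁ P) →
    (∀ i → P i → a ≤ toℕ i × toℕ i < a + c) → (∀ i → a ≤ toℕ i → toℕ i < a + c → P i) →
    𝟙 (P? zero) + ∑ (𝟙 ∘ P? ∘ suc) (allFin n) ≡ c
  split zero zero _ P? to from = cong₂ _+_ (𝟙-no (P? zero) λ p → contradiction (proj₂ (to zero p)) λ ())
    (∑-interval n 0 0 z≤n (P? ∘ suc) (λ i p → contradiction (proj₂ (to (suc i) p)) λ ()) (λ _ _ ()))
  split zero (suc c) (s≤s c≤n) P? to from = cong₂ _+_ (𝟙-yes (P? zero) (from zero z≤n (s≤s z≤n)))
    (∑-interval n 0 c c≤n (P? ∘ suc) (λ i p → z≤n , ≤-pred (proj₂ (to (suc i) p)))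
      (λ i _ i< → from (suc i) z≤n (s≤s i<)))
  split (suc a) c (s≤s a+c≤n) P? to from = cong₂ _+_ (𝟙-no (P? zero) λ p → contradiction (proj₁ (to zero p)) λ ())
    (∑-interval n a c a+c≤n (P? ∘ suc) (λ i p → ≤-pred (proj₁ (to (suc i) p)) , ≤-pred (proj₂ (to (suc i) p)))
      (λ i a≤ i< → from (suc i) (s≤s a≤) (s≤s i<)))

argmax : ∀ {n} (f : Fin (suc n) → ℕ) → ∃ λ i → ∀ j → f j ≤ f i
argmax {zero} f = zero , λ { zero → ≤-refl }
argmax {suc n} f with argmax (f ∘ suc)
... | i , max with ≤-total (f zero) (f (suc i))
...   | inj₁ f0≤ = suc i , λ { zero → f0≤ ; (suc j) → max j }
...   | inj₂ ≤f0 = zero , λ { zero → ≤-refl ; (suc j) → ≤-trans (max j) ≤f0 }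

module _ {n : ℕ} {G : Graph n} {ℓ : ℕ} (C : Cycle G ℓ) where
  open Graph G using (_~_) renaming (sym to ~-sym)
  open Cycle C

  -- These are the predecessor and the successor along the cycle, with wrap-around at the first and
  -- the last index; they differ because there are at least three indices.
  cycle-neighbours : ∀ i → ∃₂ λ a b → a ≢ b × vertex a ~ vertex i × vertex b ~ vertex i
  cycle-neighbours zero = suc zero , fromℕ (2 + ℓ) , (λ ()) , ~-sym (step zero) , close
  cycle-neighbours (suc i) with i Fin.≟ fromℕ (1 + ℓ)
  ... | yes refl = inject₁ i , zero , (λ ()) , step i , ~-sym close
  ... | no i≢last = inject₁ i , suc i⁺ , inject₁≢ , step i ,
    ~-sym (subst (λ x → vertex x ~ vertex (suc i⁺)) inject₁-i⁺ (step i⁺))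
    where
    -- `inject₁ i⁺` is the index `suc i` itself and `suc i⁺` the next one, as `step` requires.
    i⁺ : Fin (2 + ℓ)
    i⁺ = suc (lower₁ i (λ eq → i≢last (toℕ-injective (trans (sym eq) (sym (Fin.toℕ-fromℕ (1 + ℓ)))))))
    inject₁-i⁺ : inject₁ i⁺ ≡ suc i
    inject₁-i⁺ = cong suc (Fin.inject₁-lower₁ i _)
    inject₁≢ : inject₁ i ≢ suc i⁺
    inject₁≢ eq = <⇒≢ (m<n⇒m<1+n (n<1+n (toℕ i))) (begin
      toℕ i              ≡⟨ Fin.toℕ-inject₁ i ⟨
      toℕ (inject₁ i)    ≡⟨ cong toℕ eq ⟩
      suc (toℕ i⁺)       ≡⟨ cong suc (Fin.toℕ-inject₁ i⁺) ⟨
      suc (toℕ (inject₁ i⁺)) ≡⟨ cong (suc ∘ toℕ) inject₁-i⁺ ⟩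
      2 + toℕ i          ∎)
      where open ≡-Reasoning

-- Trees given by a parent function

module ParentTree {n : ℕ} (0<n : 0 < n) (p : ℕ → ℕ) (p< : ∀ {v} → 0 < v → p v < v) where

  infix 4 _↣_ _↣?_
  -- The condition `0 < toℕ v` keeps the root from having a parent, whatever value p takes at 0.
  _↣_ : Fin n → Fin n → Set
  u ↣ v = 0 < toℕ v × p (toℕ v) ≡ toℕ u

  _↣?_ : ∀ u v → Dec (u ↣ v)
  u ↣? v = (0 <? toℕ v) ×-dec (p (toℕ v) ℕ.≟ toℕ u)

  ↣⇒< : ∀ {u v} → u ↣ v → toℕ u < toℕ v
  ↣⇒< (0<v , pv≡u) = subst (_< _) pv≡u (p< 0<v)

  T : Graph n
  T = record
    { _~_    = λ u v → u ↣ v ⊎ v ↣ u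
    ; _~?_   = λ u v → (u ↣? v) ⊎-dec (v ↣? u)
    ; sym    = [ inj₂ , inj₁ ]′
    ; irrefl = λ { refl → [ <-irrefl refl ∘ ↣⇒< , <-irrefl refl ∘ ↣⇒< ]′ }
    }

  open Graph T using (_~_) renaming (sym to ~-sym)

  root : Fin n
  root = fromℕ< 0<n

  toℕ-root : toℕ root ≡ 0
  toℕ-root = toℕ-fromℕ< 0<n

  root-path : ∀ v → Acc _<_ (toℕ v) → Star _~_ root v
  root-path v (acc rec) with 0 <? toℕ v
  ... | no 0≮v = subst (Star _~_ root) (toℕ-injective (trans toℕ-root (sym (n≤0⇒n≡0 (≮⇒≥ 0≮v))))) ε
  ... | yes 0<v = root-path u (rec (subst (_< toℕ v) (sym u≡) (p< 0<v))) ◅◅ inj₁ (0<v , sym u≡) ◅ ε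
    where
    pv<n = <-trans (p< 0<v) (toℕ<n v)
    u = fromℕ< pv<n
    u≡ : toℕ u ≡ p (toℕ v)
    u≡ = toℕ-fromℕ< pv<n

  isTree : IsTree T
  isTree = record
    { nonempty  = 0<n
    ; connected = λ u v → reverse ~-sym (root-path u (<-wellFounded _)) ◅◅ root-path v (<-wellFounded _)
    ; acyclic   = acyclic
    }
    where
    -- Both cycle neighbours of the vertex with the greatest number would have to be its parent.
    acyclic : ∀ ℓ → ¬ Cycle T ℓ
    acyclic ℓ C =
      let open Cycle C
          i , max = argmax (toℕ ∘ vertex)
          a , b , a≢b , a~i , b~i = cycle-neighbours C i
          parent : ∀ {c} → vertex c ~ vertex i → p (toℕ (vertex i)) ≡ toℕ (vertex c)
          parent = λ {c} → λ { (inj₁ c↣i) → proj₂ c↣i ; (inj₂ i↣c) → contradiction (↣⇒< i↣c) (≤⇒≯ (max c)) }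
      in a≢b (distinct (toℕ-injective (trans (sym (parent a~i)) (parent b~i))))

  -- The children of v are the c numbers starting at a. `to` asks for u < n because p is defined on
  -- all numbers and may send some beyond the tree to v.
  record Children (v a c : ℕ) : Set where
    field
      bound : a + c ≤ n
      to    : ∀ {u} → u < n → 0 < u → p u ≡ v → a ≤ u × u < a + c
      from  : ∀ {u} → a ≤ u → u < a + c → 0 < u × p u ≡ v

  module _ (v : Fin n) {a c : ℕ} (ch : Children (toℕ v) a c) where
    open Children ch

    degree : deg T v ≡ ∑ (λ u → 𝟙 (u ↣? v)) (allFin n) + c
    degree = begin
      deg T v
        ≡⟨ deg≡∑ T v ⟩
      ∑ (𝔸 T v) V
        ≡⟨ ∑-cong split V ⟩
      ∑ (λ u → 𝟙 (u ↣? v) + 𝟙 (v ↣? u)) V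
        ≡⟨ ∑-+ _ _ V ⟩
      ∑ (λ u → 𝟙 (u ↣? v)) V + ∑ (λ u → 𝟙 (v ↣? u)) V
        ≡⟨ cong (∑ (λ u → 𝟙 (u ↣? v)) V +_)
             (∑-interval n a c bound (v ↣?_) (λ u (0<u , pu≡v) → to (toℕ<n u) 0<u pu≡v) (λ _ → from)) ⟩
      ∑ (λ u → 𝟙 (u ↣? v)) V + c ∎
      where
      open ≡-Reasoning
      V = allFin n
      split : ∀ u → 𝔸 T v u ≡ 𝟙 (u ↣? v) + 𝟙 (v ↣? u)
      split u = trans (𝟙-⊎ (v ↣? u) (u ↣? v) λ v↣u u↣v → <-asym (↣⇒< v↣u) (↣⇒< u↣v)) (+-comm (𝟙 (v ↣? u)) _)

    degree-root : toℕ v ≡ 0 → deg T v ≡ c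
    degree-root v≡0 = trans degree (cong (_+ c) (∑-interval n 0 0 z≤n (_↣? v)
      (λ u (0<v , _) → contradiction v≡0 (>⇒≢ 0<v)) (λ _ _ ())))

    degree-nonroot : 0 < toℕ v → deg T v ≡ suc c
    degree-nonroot 0<v = trans degree (cong (_+ c) (∑-interval n (p (toℕ v)) 1 bound′ (_↣? v)
      (λ u (_ , pv≡u) → ≤-reflexive pv≡u , ≤-reflexive (trans (+-comm 1 (toℕ u)) (cong (_+ 1) (sym pv≡u))))
      (λ u p≤u u<p+1 → 0<v , ≤-antisym p≤u (≤-pred (subst (toℕ u <_) (+-comm (p (toℕ v)) 1) u<p+1)))))
      where
      bound′ : p (toℕ v) + 1 ≤ n
      bound′ = subst (_≤ n) (+-comm 1 (p (toℕ v))) (<-trans (p< 0<v) (toℕ<n v))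

-- Conditions of the family that follow from the edge types

Edge-≢ : ∀ {Δ d p q} → 2 < d → d < Δ → Edge Δ d p q → p ≢ q
Edge-≢ 2<d d<Δ 1–Δ = <⇒≢ (<-trans (<-trans (s≤s (s≤s z≤n)) 2<d) d<Δ)
Edge-≢ 2<d d<Δ 2–Δ = <⇒≢ (<-trans 2<d d<Δ)
Edge-≢ 2<d d<Δ d–Δ = <⇒≢ d<Δ
Edge-≢ 2<d d<Δ d–2 = >⇒≢ 2<d

Edge-nonLeaf : ∀ {Δ d p q} → 2 < d → d < Δ → EdgeType Δ d p q → 2 ≤ p → p ≢ Δ → 1 < q
Edge-nonLeaf 2<d d<Δ (inj₁ 1–Δ) (s≤s ()) _
Edge-nonLeaf 2<d d<Δ (inj₁ 2–Δ) _ _ = <⇒≤ (<-trans 2<d d<Δ)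
Edge-nonLeaf 2<d d<Δ (inj₁ d–Δ) _ _ = <⇒≤ (<-trans 2<d d<Δ)
Edge-nonLeaf 2<d d<Δ (inj₁ d–2) _ _ = ≤-refl
Edge-nonLeaf 2<d d<Δ (inj₂ 1–Δ) _ Δ≢Δ = contradiction refl Δ≢Δ
Edge-nonLeaf 2<d d<Δ (inj₂ 2–Δ) _ Δ≢Δ = contradiction refl Δ≢Δ
Edge-nonLeaf 2<d d<Δ (inj₂ d–Δ) _ Δ≢Δ = contradiction refl Δ≢Δ
Edge-nonLeaf 2<d d<Δ (inj₂ d–2) _ _ = <⇒≤ 2<d

module _ {n : ℕ} (G : Graph n) {Δ d : ℕ} (2<d : 2 < d) (d<Δ : d < Δ)
  (edge-type : ∀ {u v} → Graph._~_ G u v → EdgeType Δ d (deg G u) (deg G v)) where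

  -- No edge type joins equal degrees, which settles conditions (3) and (5) together.
  mᵢᵢ≡0 : ∀ i → m G i i ≡ 0
  mᵢᵢ≡0 i = cong length (filter-none
    (λ (u , v) → ((deg G u ℕ.≟ i) ×-dec (deg G v ℕ.≟ i)) ⊎-dec ((deg G u ℕ.≟ i) ×-dec (deg G v ℕ.≟ i)))
    {xs = edges G} (All.tabulate λ {(u , v)} e∈ →
    let no-loop = λ (du , dv) → [ (λ e → Edge-≢ 2<d d<Δ e (trans du (sym dv)))
                                , (λ e → Edge-≢ 2<d d<Δ e (trans dv (sym du))) ]′ (edge-type (∈-edges⁻ G e∈))
    in [ no-loop , no-loop ]′))

  -- Leaves are adjacent to vertices of degree Δ only. At any other vertex of degree at least 2 the
  -- filter therefore keeps all neighbours, hence more than one.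
  internalLeaf⇒Δ : ∀ v → InternalLeaf G v → deg G v ≡ Δ
  internalLeaf⇒Δ v (2≤dv , one) with deg G v ℕ.≟ Δ
  ... | yes dv≡Δ = dv≡Δ
  ... | no  dv≢Δ = contradiction (trans (sym one) (cong length (filter-all _ (All.tabulate λ u∈ →
    Edge-nonLeaf 2<d d<Δ (edge-type (∈-neighbours⁻ G u∈)) 2≤dv dv≢Δ)))) (<⇒≢ 2≤dv)

module Blocks (δ : ℕ) where

  Δ : ℕ
  Δ = suc δ

  blocks-unique : ∀ {r r′ i i′} → r ≤ δ → r′ ≤ δ → r + i * Δ ≡ r′ + i′ * Δ → r ≡ r′ × i ≡ i′
  blocks-unique {r} {r′} {i} {i′} r≤ r′≤ eq =
    r≡r′ , *-cancelʳ-≡ i i′ Δ (+-cancelˡ-≡ r _ _ (trans eq (cong (_+ i′ * Δ) (sym r≡r′))))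
    where
    open ≡-Reasoning
    r≡r′ : r ≡ r′
    r≡r′ = begin
      r                  ≡⟨ m<n⇒m%n≡m (s≤s r≤) ⟨
      r % Δ              ≡⟨ [m+kn]%n≡m%n r i Δ ⟨
      (r + i * Δ) % Δ    ≡⟨ cong (_% Δ) eq ⟩
      (r′ + i′ * Δ) % Δ  ≡⟨ [m+kn]%n≡m%n r′ i′ Δ ⟩
      r′ % Δ             ≡⟨ m<n⇒m%n≡m (s≤s r′≤) ⟩
      r′                 ∎

-- Vertex 0 is w and 1, …, j are its neighbours of degree 2. Then follow k blocks of Δ vertices: a vertex
-- of degree Δ and Δ − 1 children of it. The first vertex of block i hangs from w if i = 0, from the
-- vertex i if 1 ≤ i ≤ j, and otherwise from the last vertex of the previous block.
module Construction {n δ k j : ℕ} (n≡ : n ≡ suc j + k * suc δ) (2≤j : 2 ≤ j) (j<δ : j < δ) (j<k : j < k) where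
  open Blocks δ

  d : ℕ
  d = suc j

  vertex : ℕ → ℕ → ℕ
  vertex i r = d + (r + i * Δ)

  data Position : ℕ → Set where
    low   : ∀ {v} → v ≤ j → Position v
    block : ∀ i r → r ≤ δ → Position (vertex i r)

  position : ∀ v → Position v
  position v with v ≤? j
  ... | yes v≤j = low v≤j
  ... | no  v≰j = subst Position
    (trans (cong (d +_) (sym (m≡m%n+[m/n]*n (v ∸ d) Δ))) (m+[n∸m]≡n (≰⇒> v≰j)))
    (block ((v ∸ d) / Δ) ((v ∸ d) % Δ) (≤-pred (m%n<n (v ∸ d) Δ)))

  -- `j + i * Δ` is the number just before `vertex i 0`, that is, the last vertex of block i - 1;
  -- such a block exists as i > j in this branch.
  blockParent : ℕ → ℕ → ℕ
  blockParent i zero    = if does (i ≤? j) then i else j + i * Δ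
  blockParent i (suc r) = vertex i 0

  parent : ℕ → ℕ
  parent v = if does (v ≤? j) then 0 else blockParent ((v ∸ d) / Δ) ((v ∸ d) % Δ)

  parent-low : ∀ {v} → v ≤ j → parent v ≡ 0
  parent-low {v} v≤j rewrite dec-true (v ≤? j) v≤j = refl

  parent-block : ∀ {i r} → r ≤ δ → parent (vertex i r) ≡ blockParent i r
  parent-block {i} {r} r≤δ rewrite dec-false (vertex i r ≤? j) (<⇒≱ (s≤s (m≤m+n j _))) =
    let r≡ , i≡ = blocks-unique (≤-pred (m%n<n (vertex i r ∸ d) Δ)) r≤δ
                    (trans (sym (m≡m%n+[m/n]*n (vertex i r ∸ d) Δ)) (m+n∸m≡n d (r + i * Δ)))
    in cong₂ blockParent i≡ r≡

  parent-head-low : ∀ {i} → i ≤ j → parent (vertex i 0) ≡ i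
  parent-head-low {i} i≤j = trans (parent-block {i} z≤n) (cong (if_then i else j + i * Δ) (dec-true (i ≤? j) i≤j))

  parent-head-high : ∀ {i} → j ≤ i → parent (vertex (suc i) 0) ≡ vertex i δ
  parent-head-high {i} j≤i = begin
    parent (vertex (suc i) 0)  ≡⟨ parent-block {suc i} z≤n ⟩
    blockParent (suc i) 0      ≡⟨ cong (if_then suc i else j + suc i * Δ) (dec-false (suc i ≤? j) (<⇒≱ (s≤s j≤i))) ⟩
    j + suc (δ + i * Δ)        ≡⟨ +-suc j _ ⟩
    vertex i δ                 ∎
    where open ≡-Reasoning

  low<vertex : ∀ {v} i r → v ≤ j → v < vertex i r
  low<vertex i r v≤j = s≤s (≤-trans v≤j (m≤m+n j _))

  vertex≢low : ∀ {v} i r → v ≤ j → vertex i r ≢ v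
  vertex≢low i r v≤j = >⇒≢ (low<vertex i r v≤j)

  vertex-injective : ∀ {i i′ r r′} → r ≤ δ → r′ ≤ δ → vertex i r ≡ vertex i′ r′ → r ≡ r′ × i ≡ i′
  vertex-injective r≤ r′≤ eq = blocks-unique r≤ r′≤ (+-cancelˡ-≡ d _ _ eq)

  vertex<n : ∀ {i r} → i < k → r ≤ δ → vertex i r < n
  vertex<n {i} {r} i<k r≤δ = subst (vertex i r <_) (sym n≡)
    (+-monoʳ-< d (<-≤-trans (+-monoˡ-< (i * Δ) (s≤s r≤δ)) (*-monoˡ-≤ Δ i<k)))

  vertex<n⇒ : ∀ {i r} → vertex i r < n → i < k
  vertex<n⇒ {i} {r} v<n = *-cancelʳ-< Δ i k
    (≤-<-trans (m≤n+m (i * Δ) r) (+-cancelˡ-< d _ _ (subst (vertex i r <_) n≡ v<n)))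

  -- The graph of `parent` on the positive numbers as an inductive family, so that later proofs
  -- match on cases instead of handling quotients and remainders.
  data Parent : ℕ → ℕ → Set where
    w↣low      : ∀ {v} → 0 < v → v ≤ j → Parent 0 v
    low↣head   : ∀ {i} → i ≤ j → Parent i (vertex i 0)
    last↣head  : ∀ {i} → j ≤ i → Parent (vertex i δ) (vertex (suc i) 0)
    head↣block : ∀ {i r} → suc r ≤ δ → Parent (vertex i 0) (vertex i (suc r))

  parent-of : ∀ {v} → 0 < v → Parent (parent v) v
  parent-of {v} 0<v with position v
  ... | low v≤j = subst (λ u → Parent u v) (sym (parent-low v≤j)) (w↣low 0<v v≤j)
  ... | block i (suc r) r≤δ = subst (λ u → Parent u v) (sym (parent-block {i} r≤δ)) (head↣block {i} r≤δ)
  ... | block i zero _ with i ≤? j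
  ...   | yes i≤j = subst (λ u → Parent u v) (sym (parent-head-low i≤j)) (low↣head i≤j)
  ...   | no  i≰j with i
  ...     | zero   = contradiction z≤n i≰j
  ...     | suc i′ = subst (λ u → Parent u (vertex (suc i′) 0)) (sym (parent-head-high j≤i′)) (last↣head j≤i′)
    where j≤i′ = ≤-pred (≰⇒> i≰j)

  Parent⇒parent : ∀ {u v} → Parent u v → 0 < v × parent v ≡ u
  Parent⇒parent (w↣low 0<v v≤j)  = 0<v , parent-low v≤j
  Parent⇒parent (low↣head i≤j)   = s≤s z≤n , parent-head-low i≤j
  Parent⇒parent (last↣head j≤i)  = s≤s z≤n , parent-head-high j≤i
  Parent⇒parent (head↣block {i} r≤δ) = s≤s z≤n , parent-block {i} r≤δ

  Parent-< : ∀ {u v} → Parent u v → u < v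
  Parent-< (w↣low 0<v _)        = 0<v
  Parent-< (low↣head {i} i≤j)   = low<vertex i 0 i≤j
  Parent-< (last↣head {i} _)    = +-monoʳ-< d (n<1+n (δ + i * Δ))
  Parent-< (head↣block {i} {r} _) = +-monoʳ-< d (s≤s (m≤n+m (i * Δ) r))

  0<n : 0 < n
  0<n = subst (0 <_) (sym n≡) (s≤s z≤n)

  open ParentTree 0<n parent (λ 0<v → Parent-< (parent-of 0<v)) public

  -- `to` speaks of x with an equation x ≡ v because indices such as `vertex i δ` do not unify by
  -- matching; `vertex-injective` evaluates the equation instead.
  children : ∀ {v a c} → a + c ≤ n →
    (∀ {x u} → Parent x u → x ≡ v → u < n → a ≤ u × u < a + c) →
    (∀ {u} → a ≤ u → u < a + c → Parent v u) → Children v a c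
  children bound to from = record
    { bound = bound
    ; to    = λ u<n 0<u eq → to (parent-of 0<u) eq u<n
    ; from  = λ a≤u u< → Parent⇒parent (from a≤u u<)
    }

  ∈-singleton : ∀ {a u} → a ≡ u → a ≤ u × u < a + 1
  ∈-singleton {a} refl = ≤-refl , ≤-reflexive (+-comm 1 a)

  singleton-≡ : ∀ {a u} → a ≤ u → u < a + 1 → a ≡ u
  singleton-≡ {a} {u} a≤u u< = ≤-antisym a≤u (≤-pred (subst (u <_) (+-comm a 1) u<))

  n≥1+ : ∀ {a} → a < n → a + 1 ≤ n
  n≥1+ {a} = subst (_≤ n) (+-comm 1 a)

  vertex-0-0 : vertex 0 0 ≡ d
  vertex-0-0 = +-identityʳ d

  -- The head of block 0 has number d = j + 1 and thus continues the interval 1, ..., j.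
  root-children : Children 0 1 d
  root-children = children (subst (_≤ n) (cong suc vertex-0-0) (vertex<n {0} {0} (≤-trans (s≤s z≤n) j<k) z≤n)) to from
    where
    to : ∀ {x u} → Parent x u → x ≡ 0 → u < n → 1 ≤ u × u < 1 + d
    to (w↣low 0<v v≤j) _ _ = 0<v , s≤s (m≤n⇒m≤1+n v≤j)
    to (low↣head i≤j) refl _ = s≤s z≤n , ≤-reflexive (cong suc vertex-0-0)
    to (last↣head _) ()
    to (head↣block _) ()
    from : ∀ {u} → 1 ≤ u → u < 1 + d → Parent 0 u
    from {u} 0<u u<1+d with u ≤? j
    ... | yes u≤j = w↣low 0<u u≤j
    ... | no  u≰j = subst (Parent 0) (trans vertex-0-0 (≤-antisym (≰⇒> u≰j) (≤-pred u<1+d))) (low↣head z≤n)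

  low-children : ∀ {v} → 0 < v → v ≤ j → Children v (vertex v 0) 1
  -- The head of block v belongs to the tree because v ≤ j < k.
  low-children {v} 0<v v≤j = children (n≥1+ (vertex<n (≤-<-trans v≤j j<k) z≤n)) to
    (λ {u} a≤u u< → subst (Parent v) (singleton-≡ a≤u u<) (low↣head v≤j))
    where
    to : ∀ {x u} → Parent x u → x ≡ v → u < n → vertex v 0 ≤ u × u < vertex v 0 + 1
    to (w↣low _ _) refl _ = contradiction refl (<⇒≢ 0<v)
    to (low↣head _) refl _ = ∈-singleton refl
    to (last↣head {i} _) eq _ = contradiction eq (vertex≢low i δ v≤j)
    to (head↣block {i} _) eq _ = contradiction eq (vertex≢low i 0 v≤j)

  head-children : ∀ {i} → i < k → Children (vertex i 0) (vertex i 1) δ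
  head-children {i} i<k = children
    (subst (_≤ n) (sym (trans (shift δ) (+-suc d (δ + i * Δ)))) (vertex<n i<k ≤-refl))
    to from
    where
    shift : ∀ r → vertex i 1 + r ≡ vertex i (suc r)
    shift r = lemma d r (i * Δ)
      where
      lemma : ∀ a r b → a + (1 + b) + r ≡ a + (1 + r + b)
      lemma = solve-∀
    to : ∀ {x u} → Parent x u → x ≡ vertex i 0 → u < n → vertex i 1 ≤ u × u < vertex i 1 + δ
    to (low↣head i≤j) eq _ = contradiction (sym eq) (vertex≢low i 0 i≤j)
    to (last↣head {i′} _) eq _ =
      contradiction (proj₁ (vertex-injective {i′} {i} ≤-refl z≤n eq)) (>⇒≢ (≤-trans (s≤s z≤n) j<δ))
    to (head↣block {i′} {r} r<δ) eq _ with refl ← proj₂ (vertex-injective {i′} {i} z≤n z≤n eq) =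
      subst (vertex i 1 ≤_) (shift r) (m≤m+n _ r) , subst (_< vertex i 1 + δ) (shift r) (+-monoʳ-< (vertex i 1) r<δ)
    from : ∀ {u} → vertex i 1 ≤ u → u < vertex i 1 + δ → Parent (vertex i 0) u
    from {u} a≤u u< = subst (Parent (vertex i 0)) (trans (sym (shift (u ∸ vertex i 1))) (m+[n∸m]≡n a≤u))
      (head↣block {i} (+-cancelˡ-< (vertex i 1) _ _ (subst (_< vertex i 1 + δ) (sym (m+[n∸m]≡n a≤u)) u<)))

  -- One analysis serves the vertices that carry another block and the leaves. The bound `suc i < k`
  -- comes from u < n: the last vertex of the final block is a leaf.
  block-child : ∀ {x u i r} → 0 < r → r ≤ δ → Parent x u → x ≡ vertex i r → u < n →
    r ≡ δ × j ≤ i × suc i < k × u ≡ vertex (suc i) 0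
  block-child _ _ (w↣low _ _) ()
  block-child {i = i} {r} 0<r r≤δ (low↣head i≤j) eq _ = contradiction (sym eq) (vertex≢low i r i≤j)
  block-child {i = i} {r} 0<r r≤δ (head↣block {i′} _) eq _ =
    contradiction (proj₁ (vertex-injective {i′} {i} z≤n r≤δ eq)) (<⇒≢ 0<r)
  block-child {i = i} {r} 0<r r≤δ (last↣head {i′} j≤i) eq u<n with vertex-injective {i′} {i} ≤-refl r≤δ eq
  ... | refl , refl = refl , j≤i , vertex<n⇒ {suc i} {0} u<n , refl

  last-children : ∀ {i} → j ≤ i → suc i < k → Children (vertex i δ) (vertex (suc i) 0) 1
  last-children {i} j≤i i<k = children (n≥1+ (vertex<n i<k z≤n)) to
    (λ {u} a≤u u< → subst (Parent (vertex i δ)) (singleton-≡ a≤u u<) (last↣head j≤i))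
    where
    to : ∀ {x u} → Parent x u → x ≡ vertex i δ → u < n → vertex (suc i) 0 ≤ u × u < vertex (suc i) 0 + 1
    to p eq u<n =
      let _ , _ , _ , u≡ = block-child {i = i} (≤-trans (s≤s z≤n) j<δ) ≤-refl p eq u<n in ∈-singleton (sym u≡)

  leaf-children : ∀ {i r} → 0 < r → r ≤ δ → ¬ (r ≡ δ × j ≤ i × suc i < k) → Children (vertex i r) 0 0
  leaf-children {i} 0<r r≤δ ¬last = children z≤n
    (λ p eq u<n → let r≡ , j≤i , i<k , _ = block-child {i = i} 0<r r≤δ p eq u<n
                  in contradiction (r≡ , j≤i , i<k) ¬last)
    (λ _ ())

  deg-root : ∀ v → toℕ v ≡ 0 → deg T v ≡ d
  deg-root v v≡0 = degree-root v (subst (λ x → Children x 1 d) (sym v≡0) root-children) v≡0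

  deg-nonroot : ∀ v {x a c} → toℕ v ≡ x → 0 < x → Children x a c → deg T v ≡ suc c
  deg-nonroot v refl 0<x ch = degree-nonroot v ch 0<x

  deg-low : ∀ v → 0 < toℕ v → toℕ v ≤ j → deg T v ≡ 2
  deg-low v 0<v v≤j = degree-nonroot v (low-children 0<v v≤j) 0<v

  deg-head : ∀ v {i} → toℕ v ≡ vertex i 0 → deg T v ≡ Δ
  deg-head v {i} eq = deg-nonroot v eq (s≤s z≤n) (head-children (vertex<n⇒ {i} {0} (subst (_< n) eq (toℕ<n v))))

  deg-last : ∀ v {i} → toℕ v ≡ vertex i δ → j ≤ i → suc i < k → deg T v ≡ 2
  deg-last v eq j≤i i<k = deg-nonroot v eq (s≤s z≤n) (last-children j≤i i<k)

  deg-block : ∀ v {i r} → toℕ v ≡ vertex i r → 0 < r → r ≤ δ → deg T v ≡ 1 ⊎ deg T v ≡ 2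
  deg-block v {i} {r} eq 0<r r≤δ with (r ℕ.≟ δ) ×-dec (j ≤? i) ×-dec (suc i <? k)
  ... | yes (refl , j≤i , i<k) = inj₂ (deg-last v eq j≤i i<k)
  ... | no ¬last = inj₁ (deg-nonroot v eq (s≤s z≤n) (leaf-children {i} 0<r r≤δ ¬last))

  2<d : 2 < d
  2<d = s≤s 2≤j

  d<Δ : d < Δ
  d<Δ = s≤s j<δ

  ↣-edge-type : ∀ {u v x y} → Parent x y → x ≡ toℕ u → y ≡ toℕ v → EdgeType Δ d (deg T u) (deg T v)
  ↣-edge-type {u} {v} (w↣low 0<v v≤j) u≡ refl
    rewrite deg-root u (sym u≡) | deg-low v 0<v v≤j = inj₁ d–2
  -- Block 0 hangs from w itself; its head is the neighbour of degree Δ in condition (4).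
  ↣-edge-type {u} {v} (low↣head {zero} _) u≡ v≡
    rewrite deg-root u (sym u≡) | deg-head v {0} (sym v≡) = inj₁ d–Δ
  ↣-edge-type {u} {v} (low↣head {suc i} i<j) u≡ v≡
    rewrite deg-low u (subst (0 <_) u≡ (s≤s z≤n)) (subst (_≤ j) u≡ i<j) | deg-head v {suc i} (sym v≡) = inj₁ 2–Δ
  ↣-edge-type {u} {v} (last↣head {i} j≤i) u≡ v≡
    rewrite deg-last u {i} (sym u≡) j≤i (vertex<n⇒ {suc i} {0} (subst (_< n) (sym v≡) (toℕ<n v)))
          | deg-head v {suc i} (sym v≡) = inj₁ 2–Δ
  ↣-edge-type {u} {v} (head↣block {i} {r} r<δ) u≡ v≡ rewrite deg-head u {i} (sym u≡)
    with deg T v | deg-block v {i} (sym v≡) (s≤s z≤n) r<δ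
  ... | _ | inj₁ refl = inj₂ 1–Δ
  ... | _ | inj₂ refl = inj₂ 2–Δ

  edge-type : ∀ {u v} → Graph._~_ T u v → EdgeType Δ d (deg T u) (deg T v)
  edge-type (inj₁ (0<v , eq)) = ↣-edge-type (parent-of 0<v) eq refl
  edge-type (inj₂ (0<u , eq)) = [ inj₂ , inj₁ ]′ (↣-edge-type (parent-of 0<u) eq refl)

  nonroot-degrees : ∀ v → v ≢ root → deg T v ≡ 1 ⊎ deg T v ≡ 2 ⊎ deg T v ≡ Δ
  nonroot-degrees v v≢root = go (position (toℕ v)) refl
    where
    go : ∀ {x} → Position x → x ≡ toℕ v → deg T v ≡ 1 ⊎ deg T v ≡ 2 ⊎ deg T v ≡ Δ
    go (low v≤j) refl =
      inj₂ (inj₁ (deg-low v (n≢0⇒n>0 λ v≡0 → v≢root (toℕ-injective (trans v≡0 (sym toℕ-root)))) v≤j))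
    go (block i zero _) eq = inj₂ (inj₂ (deg-head v {i} (sym eq)))
    go (block i (suc r) r≤δ) eq = [ inj₁ , inj₂ ∘ inj₁ ]′ (deg-block v {i} (sym eq) (s≤s z≤n) r≤δ)

  deg≤Δ : ∀ v → deg T v ≤ Δ
  deg≤Δ v with v Fin.≟ root
  ... | yes refl = subst (_≤ Δ) (sym (deg-root v toℕ-root)) (<⇒≤ d<Δ)
  ... | no v≢root with nonroot-degrees v v≢root
  ...   | inj₁ d1        = ≤-trans (≤-reflexive d1) (s≤s z≤n)
  ...   | inj₂ (inj₁ d2) = ≤-trans (≤-reflexive d2) (<⇒≤ (<-trans 2<d d<Δ))
  ...   | inj₂ (inj₂ dΔ) = ≤-reflexive dΔ

  -- The root has no parent, so only its children have to be sorted by degree.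
  root-neighbours : ∀ c a b → a + b ≤ n →
    (∀ u → root ↣ u → deg T u ≡ c → a ≤ toℕ u × toℕ u < a + b) →
    (∀ u → a ≤ toℕ u → toℕ u < a + b → root ↣ u × deg T u ≡ c) →
    neighboursOfDegree T c root ≡ b
  root-neighbours c a b bound to from = begin
    neighboursOfDegree T c root
      ≡⟨ length-filter≡∑ (λ u → deg T u ℕ.≟ c) (neighbours T root) ⟩
    ∑ (λ u → 𝟙 (deg T u ℕ.≟ c)) (neighbours T root)
      ≡⟨ ∑-neighbours T root (λ u → 𝟙 (deg T u ℕ.≟ c)) ⟩
    ∑ (λ u → 𝔸 T root u * 𝟙 (deg T u ℕ.≟ c)) (allFin n)
      ≡⟨ ∑-cong (λ u → sym (𝟙-× (Graph._~?_ T root u) (deg T u ℕ.≟ c))) (allFin n) ⟩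
    ∑ (λ u → 𝟙 (Graph._~?_ T root u ×-dec (deg T u ℕ.≟ c))) (allFin n)
      ≡⟨ ∑-interval n a b bound (λ u → Graph._~?_ T root u ×-dec (deg T u ℕ.≟ c)) to′
           (λ u a≤u u< → let r↣u , du = from u a≤u u< in inj₁ r↣u , du) ⟩
    b ∎
    where
    open ≡-Reasoning
    to′ : ∀ u → Graph._~_ T root u × deg T u ≡ c → a ≤ toℕ u × toℕ u < a + b
    to′ u (inj₁ r↣u , du) = to u r↣u du
    to′ u (inj₂ (0<r , _) , du) = contradiction toℕ-root (>⇒≢ 0<r)

  root↣⇒≤d : ∀ u → root ↣ u → toℕ u ≤ d
  root↣⇒≤d u (0<u , eq) = ≤-pred (proj₂ (Children.to root-children (toℕ<n u) 0<u (trans eq toℕ-root)))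

  root↣ : ∀ u → 0 < toℕ u → toℕ u ≤ d → root ↣ u
  root↣ u 0<u u≤d = let 0<u , eq = Children.from root-children 0<u (s≤s u≤d) in 0<u , trans eq (sym toℕ-root)

  deg-d : ∀ u → toℕ u ≡ d → deg T u ≡ Δ
  deg-d u u≡d = deg-head u {0} (trans u≡d (sym vertex-0-0))

  d<n : d < n
  d<n = subst (_< n) vertex-0-0 (vertex<n (≤-trans (s≤s z≤n) j<k) z≤n)

  T∈𝒯‴ : T ∈𝒯‴[ Δ , j ]
  T∈𝒯‴ = record
    { isTree         = isTree
    ; maxDegree      = deg≤Δ , fromℕ< d<n , deg-d (fromℕ< d<n) (toℕ-fromℕ< d<n)
    ; internalLeaves = internalLeaf⇒Δ T 2<d d<Δ edge-type
    ; w              = root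
    ; w-medium       = subst (3 ≤_) (sym deg-w) 2<d , subst (_< Δ) (sym deg-w) d<Δ
    ; w-degree       = trans deg-w (+-comm 1 j)
    ; other-degrees  = nonroot-degrees
    ; m₂₂≡0          = mᵢᵢ≡0 T 2<d d<Δ edge-type 2
    ; w-neighbours-2 = root-neighbours 2 1 j (<⇒≤ d<n)
        (λ u r↣u d2 → proj₁ r↣u , ≤∧≢⇒< (root↣⇒≤d u r↣u)
          (λ u≡d → <⇒≢ (<-trans 2<d d<Δ) (trans (sym d2) (deg-d u u≡d))))
        (λ u 0<u u<d → root↣ u 0<u (<⇒≤ u<d) , deg-low u 0<u (≤-pred u<d))
    ; w-neighbours-Δ = root-neighbours Δ d 1 (n≥1+ d<n)
        (λ u r↣u dΔ → ∈-singleton (sym (≤-antisym (root↣⇒≤d u r↣u)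
          (≰⇒> λ u≤j → <⇒≢ (<-trans 2<d d<Δ) (trans (sym (deg-low u (proj₁ r↣u) u≤j)) dΔ)))))
        (λ u d≤u u< → root↣ u (≤-trans (s≤s z≤n) d≤u) (≤-reflexive (sym (singleton-≡ d≤u u<)))
                    , deg-d u (sym (singleton-≡ d≤u u<)))
    ; mΔΔ≡0          = mᵢᵢ≡0 T 2<d d<Δ edge-type Δ
    }
    where
    deg-w : deg T root ≡ d
    deg-w = deg-root root toℕ-root

proposition8 : (Δ n k j : ℕ) → 6 ≤ Δ → n ≡ k * Δ + 1 + j → Δ ∸ 1 ≤ k → 2 ≤ j → j ≤ Δ ∸ 2 →
    (∃ λ (T : Graph n) → T ∈𝒯‴[ Δ , j ]) × ((T T′ : Graph n) → T ∈𝒯‴[ Δ , j ] → T′ ∈𝒯‴[ Δ , j ] → σ T ≡ σ T′)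
proposition8 (suc zero) _ _ _ (s≤s ())
proposition8 (suc (suc δ)) n k j _ n≡ δ≤k 2≤j j≤δ =
  (C.T , C.T∈𝒯‴) , σ-determined
  where
  n≡′ : n ≡ suc j + k * suc (suc δ)
  n≡′ = trans n≡ (trans (+-assoc (k * suc (suc δ)) 1 j) (+-comm (k * suc (suc δ)) (suc j)))
  -- The j + 1 branches at w use up the blocks 0, ..., j, and j + 1 ≤ Δ - 1 ≤ k guarantees that
  -- these exist.
  module C = Construction {n} {suc δ} {k} {j} n≡′ 2≤j (s≤s j≤δ) (≤-trans (s≤s j≤δ) δ≤k)
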